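{- Let $k\ge 4$ be an integer and let $m=3k+1$. Let $G$ be a connected $\{\theta(1,2,2),\theta(1,2,3)\}$-free graph of size $m$ with no pendant vertices. Then $q(G)\le q'(m)$, where $q'(m)$ is the largest root of $$x^4-\tfrac13(2m+19)x^3+(4m+10)x^2-\tfrac43(5m-2)x+\tfrac83(m-4)=0.$$ Moreover, equality $q(G)=q'(m)$ holds if and only if $G\cong H^{(4)}_{\frac{2m-5}{3}}$.
   Context: All graphs are finite, simple, undirected and connected. The size of a graph is its number of edges. A pendant vertex is a vertex of degree $1$. A graph is $\mathcal F$-free if it contains no member of the family $\mathcal F$ as a (not necessarily induced) subgraph. $q(G)$ denotes the signless Laplacian spectral radius of $G$, i.e. the largest eigenvalue of $Q(G)=D(G)+A(G)$, where $A(G)$ is the adjacency matrix and $D(G)$ the diagonal matrix of vertex degrees. The theta graph $\theta(l_1,\dots,l_k)$ consists of $k\ge 3$ internally disjoint paths of lengths (numbers of edges) $l_1,\dots,l_k$, all joining the same two distinct end vertices. For odd $p\ge5$, the friendship graph $F_p$ of order $p$ consists of $\frac{p-1}{2}$ triangles having precisely one vertex (the central vertex) common to all of them. For odd $p\ge 5$ and $r\ge 4$, the graph $H_p^{(r)}$, of order $p+r-1$, is obtained from $F_p$ by identifying the central vertex of $F_p$ with a vertex of the cycle $C_r$ on $r$ vertices. -}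

module Defs where

open import Level using (0ℓ)
open import Data.Empty using (⊥)
open import Data.Fin using (Fin; zero; suc; toℕ; splitAt; remQuot; punchIn; _≟_; _<?_)
open import Data.List using (List; []; _∷_; _++_; [_]; map; drop; zip; upTo; allFin; length; filter; cartesianProduct)
open import Data.List.Relation.Unary.All using (All)
open import Data.Nat as ℕ using (ℕ; zero; suc; _∸_; pred; NonZero)
open import Data.Nat.ListAction using (sum)
open import Data.Nat.DivMod using (_/_; _%_)
open import Data.Product using (Σ; ∃; _×_; _,_; proj₁; proj₂)
open import Data.Product.Properties using (≡-dec)
open import Data.Sum using (_⊎_; inj₁; inj₂; swap)
open import Data.Unit using (⊤; tt)
open import Function.Bundles using (_↔_; _⇔_; Inverse)
open import Function.Definitions using (Injective)
open import Algebra.Bundles using (CommutativeRing; Semiring)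
open import Algebra.Apartness.Bundles using (HeytingField)
import Algebra.Apartness.Properties.HeytingCommutativeRing as HeytingProperties
import Algebra.Definitions.RawSemiring as RawSemiringDefinitions
import Algebra.Properties.Ring as RingProperties
import Data.List.Membership.DecPropositional as DecMembership
open import Relation.Binary using (Rel; Decidable; Symmetric; Irreflexive; IsStrictPartialOrder)
open import Relation.Binary.Construct.Closure.ReflexiveTransitive using (Star)
open import Relation.Binary.PropositionalEquality as ≡ using (_≡_; _≢_)
open import Relation.Nullary using (¬_; yes; no; does)
open import Relation.Nullary.Decidable using (_×-dec_; _⊎-dec_; ¬?)
open import Data.Bool using (if_then_else_)

record Graph (n : ℕ) : Set₁ where
  infix 4 _∼_ _∼?_
  field
    _∼_    : Rel (Fin n) 0ℓ
    _∼?_   : Decidable _∼_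
    symm   : Symmetric _∼_
    irrefl : Irreflexive _≡_ _∼_

module _ {n : ℕ} (G : Graph n) where
  open Graph G

  degree : Fin n → ℕ
  degree u = length (filter (u ∼?_) (allFin n))

  -- Each edge {u, v} is counted once, as the pair (u , v) with u < v.
  size : ℕ
  size = length (filter (λ (u , v) → (u <? v) ×-dec (u ∼? v))
                        (cartesianProduct (allFin n) (allFin n)))

  -- The graph on no vertices counts as connected; it has size 0.
  Connected : Set
  Connected = ∀ u v → Star _∼_ u v

  NoPendantVertex : Set
  NoPendantVertex = ∀ u → degree u ≢ 1

infix 4 _≅_ _⊑_

_≅_ : ∀ {a b} → Graph a → Graph b → Set
_≅_ {a} {b} G H = Σ (Fin a ↔ Fin b) λ φ →
  ∀ u v → (Graph._∼_ G u v) ⇔ (Graph._∼_ H (Inverse.to φ u) (Inverse.to φ v))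

-- F is (isomorphic to) a not necessarily induced subgraph of G.
_⊑_ : ∀ {a b} → Graph a → Graph b → Set
_⊑_ {a} {b} F G = Σ (Fin a → Fin b) λ f →
  Injective _≡_ _≡_ f × (∀ u v → Graph._∼_ F u v → Graph._∼_ G (f u) (f v))

Free : ∀ {n} → List (∃ Graph) → Graph n → Set₁
Free 𝓕 G = All (λ (_ , F) → ¬ (F ⊑ G)) 𝓕

-- The simple graph with an edge uv whenever u ≠ v and R u v or R v u.
fromRelation : ∀ {n} {R : Rel (Fin n) 0ℓ} → Decidable R → Graph n
fromRelation {R = R} R? = record
  { _∼_    = λ u v → u ≢ v × (R u v ⊎ R v u)
  ; _∼?_   = λ u v → ¬? (u ≟ v) ×-dec (R? u v ⊎-dec R? v u)
  ; symm   = λ (u≢v , r) → (λ v≡u → u≢v (≡.sym v≡u)) , swap r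
  ; irrefl = λ u≡v (u≢v , _) → u≢v u≡v
  }

-- The edges of a path of length l from 0 to 1 whose l - 1 internal vertices
-- are s, s + 1, ….  (Intended for l ≥ 1.)
pathEdges : ℕ → ℕ → List (ℕ × ℕ)
pathEdges s l = zip vertices (drop 1 vertices)
  where vertices = 0 ∷ map (s ℕ.+_) (upTo (l ∸ 1)) ++ [ 1 ]

-- Paths of the given lengths from 0 to 1, with internal vertices taken
-- consecutively from s onwards, so that they are internally disjoint.
thetaEdges : ℕ → List ℕ → List (ℕ × ℕ)
thetaEdges s []       = []
thetaEdges s (l ∷ ls) = pathEdges s l ++ thetaEdges (s ℕ.+ (l ∸ 1)) ls

θ : (ls : List ℕ) → Graph (2 ℕ.+ sum (map pred ls))
θ ls = fromRelation λ u v → (toℕ u , toℕ v) ∈? thetaEdges 2 ls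
  where open DecMembership (≡-dec ℕ._≟_ ℕ._≟_) using (_∈?_)

-- t triangles sharing the vertex 0; the other vertices of the triangle
-- number a are those i with proj₁ (remQuot 2 i) ≡ a.
triangles : (t : ℕ) → Graph (suc (t ℕ.* 2))
triangles t = record
  { _∼_    = _~_
  ; _∼?_   = _~?_
  ; symm   = λ {u} {v} → symm u v
  ; irrefl = λ {u} → irr u
  }
  where
  block : Fin (t ℕ.* 2) → Fin t
  block i = proj₁ (remQuot {t} 2 i)

  _~_ : Rel (Fin (suc (t ℕ.* 2))) 0ℓ
  zero  ~ zero  = ⊥
  zero  ~ suc j = ⊤
  suc i ~ zero  = ⊤
  suc i ~ suc j = i ≢ j × block i ≡ block j

  _~?_ : Decidable _~_
  zero  ~? zero  = no λ ()
  zero  ~? suc j = yes tt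
  suc i ~? zero  = yes tt
  suc i ~? suc j = ¬? (i ≟ j) ×-dec (block i ≟ block j)

  symm : ∀ u v → u ~ v → v ~ u
  symm zero    (suc j) _         = tt
  symm (suc i) zero    _         = tt
  symm (suc i) (suc j) (i≢j , e) = (λ j≡i → i≢j (≡.sym j≡i)) , ≡.sym e

  irr : ∀ u {v} → u ≡ v → ¬ (u ~ v)
  irr (suc i) ≡.refl (i≢i , _) = i≢i ≡.refl

-- F_p, meaningful for odd p, in which case its order is p.
friendship : (p : ℕ) → Graph (suc ((p ∸ 1) / 2 ℕ.* 2))
friendship p = triangles ((p ∸ 1) / 2)

-- C_r, meaningful for r ≥ 3.  The order is r, written as a successor.
cycle : (r : ℕ) → Graph (suc (r ∸ 1))
cycle r = fromRelation λ u v → suc (toℕ u) % suc (r ∸ 1) ℕ.≟ toℕ v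

-- The disjoint union of G and H with the vertices u of G and v of H
-- identified; punchIn v enumerates the vertices of H other than v.
identify : ∀ {a b} → Graph a → Fin a → Graph (suc b) → Fin (suc b) → Graph (a ℕ.+ b)
identify {a} {b} G u H v = record
  { _∼_    = λ x y → splitAt a x ~ splitAt a y
  ; _∼?_   = λ x y → splitAt a x ~? splitAt a y
  ; symm   = λ {x} {y} → symm (splitAt a x) (splitAt a y)
  ; irrefl = λ { {x} ≡.refl → irr (splitAt a x) }
  }
  where
  module G = Graph G
  module H = Graph H

  _~_ : Rel (Fin a ⊎ Fin b) 0ℓ
  inj₁ x ~ inj₁ y = x G.∼ y
  inj₁ x ~ inj₂ y = x ≡ u × v H.∼ punchIn v y
  inj₂ x ~ inj₁ y = y ≡ u × v H.∼ punchIn v x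
  inj₂ x ~ inj₂ y = punchIn v x H.∼ punchIn v y

  _~?_ : Decidable _~_
  inj₁ x ~? inj₁ y = x G.∼? y
  inj₁ x ~? inj₂ y = (x ≟ u) ×-dec (v H.∼? punchIn v y)
  inj₂ x ~? inj₁ y = (y ≟ u) ×-dec (v H.∼? punchIn v x)
  inj₂ x ~? inj₂ y = punchIn v x H.∼? punchIn v y

  symm : ∀ x y → x ~ y → y ~ x
  symm (inj₁ x) (inj₁ y) e = G.symm e
  symm (inj₁ x) (inj₂ y) e = e
  symm (inj₂ x) (inj₁ y) e = e
  symm (inj₂ x) (inj₂ y) e = H.symm e

  irr : ∀ x → ¬ (x ~ x)
  irr (inj₁ x) e = G.irrefl ≡.refl e
  irr (inj₂ x) e = H.irrefl ≡.refl e

Hgraph : (p r : ℕ) → Graph (suc ((p ∸ 1) / 2 ℕ.* 2) ℕ.+ (r ∸ 1))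
Hgraph p r = identify (friendship p) zero (cycle r) zero

-- The real numbers, characterised as an Archimedean ordered field in which least
-- upper bounds exist.  The axioms are phrased constructively: the order is
-- not assumed decidable and least upper bounds are only required for located
-- sets, so that constructive models are not excluded.  With excluded middle
-- the order is total, every set is located, and this is the usual notion of a
-- complete ordered field, which is unique up to isomorphism.
record RealNumbers : Set₁ where
  field
    heytingField : HeytingField 0ℓ 0ℓ 0ℓ

  open HeytingField heytingField public

  commutativeRing : CommutativeRing 0ℓ 0ℓ
  commutativeRing = record { isCommutativeRing = isCommutativeRing }

  open CommutativeRing commutativeRing public using (ring; semiring)

  open RawSemiringDefinitions (Semiring.rawSemiring semiring) public
    using (_^_) renaming (sum to ∑; _×_ to _·_)

  ι : ℕ → Carrier
  ι n = n · 1#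

  infix 4 _<_ _≤_
  field
    _<_                  : Rel Carrier 0ℓ
    isStrictPartialOrder : IsStrictPartialOrder _≈_ _<_
    #⇒<⊎>                : ∀ {x y} → x # y → x < y ⊎ y < x
    <⇒#                  : ∀ {x y} → x < y → x # y
    +-monoˡ-<            : ∀ {x y} z → x < y → x + z < y + z
    *-pos                : ∀ {x y} → 0# < x → 0# < y → 0# < x * y

  _≤_ : Rel Carrier 0ℓ
  x ≤ y = ¬ (y < x)

  _IsUpperBoundOf_ : Carrier → (Carrier → Set) → Set
  b IsUpperBoundOf S = ∀ x → S x → x ≤ b

  Located : (Carrier → Set) → Set
  Located S = ∀ {a b} → a < b → (∃ λ x → S x × a < x) ⊎ b IsUpperBoundOf S

  field
    archimedean : ∀ x → ∃ λ n → x < ι n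
    supremum    : (S : Carrier → Set) → ∃ S → ∃ (_IsUpperBoundOf S) → Located S →
                  ∃ λ s → s IsUpperBoundOf S × (∀ {a} → a < s → ∃ λ x → S x × a < x)

  private
    module < = IsStrictPartialOrder isStrictPartialOrder
    open HeytingProperties heytingCommutativeRing using (1#0)
    open RingProperties ring using (-‿distribˡ-*; -‿involutive)

    0<1 : 0# < 1#
    0<1 with #⇒<⊎> 1#0
    ... | inj₂ 0<1 = 0<1
    ... | inj₁ 1<0 = <.<-respʳ-≈ [-1]²≈1 (*-pos 0<-1 0<-1)
      where
      0<-1 : 0# < - 1#
      0<-1 = <.<-respˡ-≈ (-‿inverseʳ 1#) (<.<-respʳ-≈ (+-identityˡ _) (+-monoˡ-< (- 1#) 1<0))

      [-1]²≈1 : - 1# * - 1# ≈ 1#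
      [-1]²≈1 = trans (sym (-‿distribˡ-* 1# (- 1#))) (trans (-‿cong (*-identityˡ _)) (-‿involutive 1#))

  0<ι : ∀ n .{{_ : NonZero n}} → 0# < ι n
  0<ι (suc zero)    = <.<-respʳ-≈ (sym (+-identityʳ 1#)) 0<1
  0<ι (suc (suc n)) = <.trans (0<ι (suc n)) (<.<-respˡ-≈ (+-identityˡ _) (+-monoˡ-< _ 0<1))

  -- #⇒invertible provides an inverse of ι n - 0#.
  infixl 7 _/ₙ_
  _/ₙ_ : Carrier → (n : ℕ) .{{_ : NonZero n}} → Carrier
  x /ₙ n = x * proj₁ (#⇒invertible {ι n} {0#} (#-sym (<⇒# (0<ι n))))

module _ (ℝ : RealNumbers) where
  open RealNumbers ℝ

  Matrix : ℕ → Set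
  Matrix n = Fin n → Fin n → Carrier

  adjacencyMatrix : ∀ {n} → Graph n → Matrix n
  adjacencyMatrix G i j = if does (Graph._∼?_ G i j) then 1# else 0#

  degreeMatrix : ∀ {n} → Graph n → Matrix n
  degreeMatrix G i j = if does (i ≟ j) then ι (degree G i) else 0#

  signlessLaplacian : ∀ {n} → Graph n → Matrix n
  signlessLaplacian G i j = degreeMatrix G i j + adjacencyMatrix G i j

  -- With excluded middle, ∃ λ i → v i # 0# says that v is nonzero.
  IsEigenvalue : ∀ {n} → Matrix n → Carrier → Set
  IsEigenvalue {n} M μ = Σ (Fin n → Carrier) λ v →
    (∃ λ i → v i # 0#) × (∀ i → ∑ (λ j → M i j * v j) ≈ μ * v i)

  IsLargest : (Carrier → Set) → Carrier → Set
  IsLargest P x = P x × (∀ y → P y → y ≤ x)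

  IsSignlessLaplacianRadius : ∀ {n} → Graph n → Carrier → Set
  IsSignlessLaplacianRadius G = IsLargest (IsEigenvalue (signlessLaplacian G))

  quartic : ℕ → Carrier → Carrier
  quartic m x = x ^ 4
              - ι (2 ℕ.* m ℕ.+ 19) /ₙ 3 * x ^ 3
              + ι (4 ℕ.* m ℕ.+ 10) * x ^ 2
              - ι 4 /ₙ 3 * (ι (5 ℕ.* m) - ι 2) * x
              + ι 8 /ₙ 3 * (ι m - ι 4)

  IsLargestRoot : ℕ → Carrier → Set
  IsLargestRoot m = IsLargest (λ x → quartic m x ≈ 0#)

{-# OPTIONS --safe #-}

-- Write y = 2k - 1 and let u be a vertex of degree d.  Counting edges by their distance
-- from u, and using that no triangle at u shares an edge with another triangle or
-- with a 4-cycle, one bounds the sum of the degrees of the neighbours of u.  If all degrees are at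
-- most y, the degree vector x satisfies Qx ≤ ((1 + y)²/y) x entrywise, and so q(G) ≤ (1 + y)²/y.
-- The quartic at x = 2 + y + s is (y + s)(s³ + 2ys² + (y² - 4)s - 2(y - 1)); the second
-- factor increases for s ≥ 0 and is negative at s = 1/y, so that q'(m) > 2 + y + 1/y = (1 + y)²/y.
-- If some degree exceeds y, it is 2k, there is exactly one vertex outside the closed
-- neighbourhood of u, and G is the graph H; a positive vector then shows that q'(m) is its
-- signless Laplacian radius.
module Submission where

open import Defs
open import Data.Nat using (ℕ; _∸_) renaming (_+_ to _+ℕ_; _*_ to _*ℕ_; _≤_ to _≤ℕ_)
open import Data.Nat.DivMod using (_/_)
open import Data.List using ([]; _∷_)
open import Data.Product using (_×_; _,_)
open import Function.Bundles using (_⇔_)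
open import Relation.Binary.PropositionalEquality using (_≡_)

-- For the degree vector, the row of `u` asks that `y (d² + σ) ≤ (1 + y)² d`, where `σ` is the
-- degree sum over the neighbours of `u`. The delicate case is `d = y`: it needs `σ ≤ 2y + 1`, while
-- the direct edge count only gives `σ ≤ 2y + 2`. The missing unit comes from a dichotomy. If at
-- least two neighbours of `u` lie in no triangle with `u`, fewer edges run inside the
-- neighbourhood. Otherwise every vertex outside has at most one neighbour among those of `u`,
-- because two would close a 4-cycle whose edges at `u` lie in no triangle. The reals are
-- axiomatised constructively: `≤` is the negation of `<`, and neither sign nor equality is
-- decidable. Hence the comparison of eigenvalues uses quadratic forms in place of Perron-Frobenius,
-- the lower bound on `q'(m)` needs a root constructed as the supremum of a located set, and the
-- final case distinction is on degrees, which are natural numbers.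

module RealArithmetic where
  open import Algebra.Bundles using (CommutativeRing)
  open import Algebra.Solver.Ring.AlmostCommutativeRing using (fromCommutativeRing; _-Raw-AlmostCommutative⟶_)
  import Algebra.Properties.Ring as RingProperties
  import Algebra.Properties.Semiring.Mult as MultProperties
  import Algebra.Properties.Semiring.Sum as SumProperties
  import Algebra.Solver.Ring as RingSolver
  open import Data.Fin using (Fin; zero; suc)
  open import Data.Integer as ℤ using (ℤ; +_; -[1+_])
  import Data.Integer.Properties as ℤ
  import Data.Nat.Properties as ℕ
  open import Data.Nat as ℕ using (ℕ; zero; suc)
  open import Data.Maybe using (map)
  open import Data.Product using (∃; _×_; _,_; proj₁; proj₂)
  import Data.Sign as Sign
  open import Data.Sum using (_⊎_; inj₁; inj₂)
  open import Function using (_∘_)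
  open import Relation.Binary using (IsStrictPartialOrder)
  open import Relation.Binary.PropositionalEquality as ≡ using (_≡_)
  open import Relation.Nullary using (¬_; contradiction)
  open import Relation.Nullary.Decidable using (dec⇒maybe)
  import Relation.Binary.Reasoning.Setoid as SetoidReasoning

  -- A ring solver with integer coefficients.

  module IntegerCoefficientSolver {c ℓ} (R : CommutativeRing c ℓ) where
    open CommutativeRing R
    open MultProperties semiring renaming (_×_ to _·_)
    open RingProperties ring
    open SetoidReasoning setoid

    -- `fromℤ (+ n)` unfolds to `ι n`, so `con (+ n)` stands for `ι n` without conversion. Since
    -- `ι 1` is `1# + 0#`, passages between `ι 1` and `1#` remain explicit.
    fromℤ : ℤ → Carrier
    fromℤ (+ n)    = n · 1#
    fromℤ -[1+ n ] = - (suc n · 1#)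

    fromℤ-neg : ∀ i → fromℤ (ℤ.- i) ≈ - fromℤ i
    fromℤ-neg (+ zero)  = sym -0#≈0#
    fromℤ-neg (+ suc n) = refl
    fromℤ-neg -[1+ n ]  = sym (-‿involutive _)

    fromℤ-⊖ : ∀ m n → fromℤ (m ℤ.⊖ n) ≈ m · 1# - n · 1#
    fromℤ-⊖ zero    zero    = sym (trans (+-congˡ -0#≈0#) (+-identityʳ _))
    fromℤ-⊖ zero    (suc n) = sym (+-identityˡ _)
    fromℤ-⊖ (suc m) zero    = sym (trans (+-congˡ -0#≈0#) (+-identityʳ _))
    fromℤ-⊖ (suc m) (suc n) = begin
      fromℤ (suc m ℤ.⊖ suc n)              ≡⟨ ≡.cong fromℤ (ℤ.[1+m]⊖[1+n]≡m⊖n m n) ⟩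
      fromℤ (m ℤ.⊖ n)                      ≈⟨ fromℤ-⊖ m n ⟩
      m · 1# - n · 1#                      ≈⟨ +-congʳ (xyx⁻¹≈y 1# (m · 1#)) ⟨
      1# + m · 1# - 1# - n · 1#            ≈⟨ +-assoc _ _ _ ⟩
      1# + m · 1# + (- 1# - n · 1#)        ≈⟨ +-congˡ (-‿+-comm _ _) ⟩
      1# + m · 1# - (1# + n · 1#)          ∎

    fromℤ-+ : ∀ i j → fromℤ (i ℤ.+ j) ≈ fromℤ i + fromℤ j
    fromℤ-+ (+ m)    (+ n)    = ×-homo-+ 1# m n
    fromℤ-+ (+ m)    -[1+ n ] = fromℤ-⊖ m (suc n)
    fromℤ-+ -[1+ m ] (+ n)    = trans (fromℤ-⊖ n (suc m)) (+-comm _ _)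
    fromℤ-+ -[1+ m ] -[1+ n ] = begin
      - (suc (suc (m ℕ.+ n)) · 1#)         ≡⟨ ≡.cong (λ k → - (k · 1#)) (ℕ-suc m n) ⟨
      - ((suc m ℕ.+ suc n) · 1#)           ≈⟨ -‿cong (×-homo-+ 1# (suc m) (suc n)) ⟩
      - (suc m · 1# + suc n · 1#)          ≈⟨ -‿+-comm _ _ ⟨
      - (suc m · 1#) - suc n · 1#          ∎
      where
      open import Data.Nat.Properties using (+-suc)
      ℕ-suc : ∀ m n → suc m ℕ.+ suc n ≡ suc (suc (m ℕ.+ n))
      ℕ-suc m n = ≡.cong suc (+-suc m n)

    fromℤ-+◃ : ∀ n → fromℤ (Sign.+ ℤ.◃ n) ≈ n · 1#
    fromℤ-+◃ n = reflexive (≡.cong fromℤ (ℤ.+◃n≡+n n))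

    fromℤ--◃ : ∀ n → fromℤ (Sign.- ℤ.◃ n) ≈ - (n · 1#)
    fromℤ--◃ zero    = sym -0#≈0#
    fromℤ--◃ (suc n) = refl

    fromℤ-* : ∀ i j → fromℤ (i ℤ.* j) ≈ fromℤ i * fromℤ j
    fromℤ-* (+ m)    (+ n)    = trans (fromℤ-+◃ (m ℕ.* n)) (×1-homo-* m n)
    fromℤ-* (+ m)    -[1+ n ] = trans (fromℤ--◃ (m ℕ.* suc n))
      (trans (-‿cong (×1-homo-* m (suc n))) (-‿distribʳ-* _ _))
    fromℤ-* -[1+ m ] (+ n)    = trans (fromℤ--◃ (suc m ℕ.* n))
      (trans (-‿cong (×1-homo-* (suc m) n)) (-‿distribˡ-* _ _))
    fromℤ-* -[1+ m ] -[1+ n ] = begin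
      fromℤ (Sign.+ ℤ.◃ (suc m ℕ.* suc n)) ≈⟨ fromℤ-+◃ (suc m ℕ.* suc n) ⟩
      (suc m ℕ.* suc n) · 1#               ≈⟨ ×1-homo-* (suc m) (suc n) ⟩
      suc m · 1# * suc n · 1#              ≈⟨ -‿involutive _ ⟨
      - - (suc m · 1# * suc n · 1#)        ≈⟨ -‿cong (-‿distribʳ-* _ _) ⟩
      - (suc m · 1# * - (suc n · 1#))      ≈⟨ -‿distribˡ-* _ _ ⟩
      - (suc m · 1#) * - (suc n · 1#)      ∎

    morphism : ℤ.+-*-rawRing -Raw-AlmostCommutative⟶ fromCommutativeRing R
    morphism = record
      { ⟦_⟧    = fromℤ
      ; +-homo = fromℤ-+
      ; *-homo = fromℤ-*
      ; -‿homo = fromℤ-neg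
      ; 0-homo = refl
      ; 1-homo = +-identityʳ 1#
      }

    open RingSolver ℤ.+-*-rawRing (fromCommutativeRing R) morphism
      (λ i j → map (λ i≡j → reflexive (≡.cong fromℤ i≡j)) (dec⇒maybe (i ℤ.≟ j))) public
      using (solve; _:=_; con; _:+_; _:*_; _:-_; :-_; _:^_)

  -- Constructive ordered field arithmetic and finite sums.

  module OrderedField (ℝ : RealNumbers) where
    open RealNumbers ℝ public hiding (zero)
    open IntegerCoefficientSolver commutativeRing public
      using (solve; _:=_; con; _:+_; _:*_; _:-_; :-_; _:^_)
    open IsStrictPartialOrder isStrictPartialOrder public
      using (<-respˡ-≈; <-respʳ-≈)
      renaming (irrefl to <-irrefl; trans to <-trans)
    open MultProperties semiring public using (×-homo-+; ×1-homo-*)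
    private module Sum = SumProperties semiring
    open Sum public
      using (∑-distrib-+; ∑-comm)
    module ≈-Reasoning = SetoidReasoning setoid

    <-asym : ∀ {x y} → x < y → ¬ (y < x)
    <-asym x<y y<x = <-irrefl refl (<-trans x<y y<x)

    <⇒≤ : ∀ {x y} → x < y → x ≤ y
    <⇒≤ = <-asym

    ≤-refl : ∀ {x} → x ≤ x
    ≤-refl = <-irrefl refl

    ≤-reflexive : ∀ {x y} → x ≈ y → x ≤ y
    ≤-reflexive x≈y = <-irrefl (sym x≈y)

    -- The substitute for totality of the order: apartness is cotransitive, and whichever apartness
    -- it returns has a sign.
    <-cotrans : ∀ {x y} → x < y → ∀ z → x < z ⊎ z < y
    <-cotrans x<y z with #-cotrans (<⇒# x<y) z
    ... | inj₁ x#z with #⇒<⊎> x#z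
    ...   | inj₁ x<z = inj₁ x<z
    ...   | inj₂ z<x = inj₂ (<-trans z<x x<y)
    <-cotrans x<y z | inj₂ z#y with #⇒<⊎> z#y
    ...   | inj₁ z<y = inj₂ z<y
    ...   | inj₂ y<z = inj₁ (<-trans x<y y<z)

    <-≤-trans : ∀ {x y z} → x < y → y ≤ z → x < z
    <-≤-trans {z = z} x<y y≤z with <-cotrans x<y z
    ... | inj₁ x<z = x<z
    ... | inj₂ z<y = contradiction z<y y≤z

    ≤-<-trans : ∀ {x y z} → x ≤ y → y < z → x < z
    ≤-<-trans {x} x≤y y<z with <-cotrans y<z x
    ... | inj₁ y<x = contradiction y<x x≤y
    ... | inj₂ x<z = x<z

    ≤-trans : ∀ {x y z} → x ≤ y → y ≤ z → x ≤ z
    ≤-trans x≤y y≤z z<x = y≤z (<-≤-trans z<x x≤y)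

    ≤-antisym : ∀ {x y} → x ≤ y → y ≤ x → x ≈ y
    ≤-antisym {x} {y} x≤y y≤x = proj₁ (tight x y) x#y⇒⊥
      where
      x#y⇒⊥ : ¬ (x # y)
      x#y⇒⊥ x#y with #⇒<⊎> x#y
      ... | inj₁ x<y = y≤x x<y
      ... | inj₂ y<x = x≤y y<x

    ≤-respʳ-≈ : ∀ {x y z} → y ≈ z → x ≤ y → x ≤ z
    ≤-respʳ-≈ y≈z x≤y z<x = x≤y (<-respˡ-≈ (sym y≈z) z<x)

    ≤-respˡ-≈ : ∀ {x y z} → x ≈ y → x ≤ z → y ≤ z
    ≤-respˡ-≈ x≈y x≤z z<y = x≤z (<-respʳ-≈ (sym x≈y) z<y)

    +-monoʳ-< : ∀ {x y} z → x < y → z + x < z + y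
    +-monoʳ-< z x<y = <-respˡ-≈ (+-comm _ _) (<-respʳ-≈ (+-comm _ _) (+-monoˡ-< z x<y))

    -- Reduces an inequality to a sign and a ring identity that the solver can check;
    -- `≤-certificate` plays the same part for `≤`.
    <-certificate : ∀ {x y p} → 0# < p → y ≈ x + p → x < y
    <-certificate {x} 0<p y≈x+p =
      <-respˡ-≈ (+-identityʳ x) (<-respʳ-≈ (sym y≈x+p) (+-monoʳ-< x 0<p))

    x<y⇒0<y-x : ∀ {x y} → x < y → 0# < y - x
    x<y⇒0<y-x {x} x<y = <-respˡ-≈ (-‿inverseʳ x) (+-monoˡ-< (- x) x<y)

    ≤-certificate : ∀ {x y p} → 0# ≤ p → y ≈ x + p → x ≤ y
    ≤-certificate {x} {y} {p} 0≤p y≈x+p y<x = 0≤p (<-certificate (x<y⇒0<y-x y<x)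
      (trans (solve 2 (λ x p → con (+ 0) := p :+ (x :- (x :+ p))) refl x p)
        (+-congˡ (+-congˡ (-‿cong (sym y≈x+p))))))

    x≤y⇒0≤y-x : ∀ {x y} → x ≤ y → 0# ≤ y - x
    x≤y⇒0≤y-x {x} {y} x≤y y-x<0 = x≤y (<-certificate (x<y⇒0<y-x y-x<0)
      (solve 2 (λ x y → x := y :+ (con (+ 0) :- (y :- x))) refl x y))

    -- A case split on the sign is admissible when the goal is a negation: given `A`, the positive
    -- case is refuted, so `x` is not apart from 0, and tightness makes it 0.
    0≤-elim : ∀ {A : Set} {x} → 0# ≤ x → (0# < x → ¬ A) → (x ≈ 0# → ¬ A) → ¬ A
    0≤-elim {x = x} 0≤x positive vanishing a = vanishing (proj₁ (tight x 0#) x#0⇒⊥) a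
      where
      x#0⇒⊥ : ¬ (x # 0#)
      x#0⇒⊥ x#0 with #⇒<⊎> x#0
      ... | inj₁ x<0 = 0≤x x<0
      ... | inj₂ 0<x = positive 0<x a

    +-nonneg : ∀ {x y} → 0# ≤ x → 0# ≤ y → 0# ≤ x + y
    +-nonneg {x} 0≤x 0≤y = ≤-trans 0≤x (≤-certificate 0≤y refl)

    +-pos-nonneg : ∀ {x y} → 0# < x → 0# ≤ y → 0# < x + y
    +-pos-nonneg 0<x 0≤y = <-≤-trans 0<x (≤-certificate 0≤y refl)

    +-nonneg-pos : ∀ {x y} → 0# ≤ x → 0# < y → 0# < x + y
    +-nonneg-pos 0≤x 0<y = <-respʳ-≈ (+-comm _ _) (+-pos-nonneg 0<y 0≤x)

    +-pos : ∀ {x y} → 0# < x → 0# < y → 0# < x + y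
    +-pos 0<x 0<y = +-pos-nonneg 0<x (<⇒≤ 0<y)

    *-nonneg : ∀ {x y} → 0# ≤ x → 0# ≤ y → 0# ≤ x * y
    *-nonneg {x} {y} 0≤x 0≤y = 0≤-elim 0≤x
      (λ 0<x → 0≤-elim 0≤y
        (λ 0<y → <⇒≤ (*-pos 0<x 0<y))
        (λ y≈0 → ≤-reflexive (sym (trans (*-congˡ y≈0) (zeroʳ x)))))
      (λ x≈0 → ≤-reflexive (sym (trans (*-congʳ x≈0) (zeroˡ y))))

    *-monoʳ-≤ : ∀ {x y z} → 0# ≤ z → x ≤ y → z * x ≤ z * y
    *-monoʳ-≤ {x} {y} {z} 0≤z x≤y = ≤-certificate (*-nonneg 0≤z (x≤y⇒0≤y-x x≤y))
      (solve 3 (λ x y z → z :* y := z :* x :+ z :* (y :- x)) refl x y z)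

    -- A positive product is invertible, so `y` has the inverse `x * i` and is apart from 0. Its
    -- sign is then decided, and a negative one would make the product negative.
    *-cancelˡ-pos : ∀ {x y} → 0# < x → 0# < x * y → 0# < y
    *-cancelˡ-pos {x} {y} 0<x 0<xy with #⇒invertible (#-sym (<⇒# 0<xy))
    ... | i , left , _ with #⇒<⊎> (invertible⇒# {y} {0#} (x * i ,
          trans (solve 3 (λ x y i → (x :* i) :* (y :- con (+ 0)) := i :* (x :* y :- con (+ 0))) refl x y i) left ,
          trans (solve 3 (λ x y i → (y :- con (+ 0)) :* (x :* i) := i :* (x :* y :- con (+ 0))) refl x y i) left))
    ...   | inj₂ 0<y = 0<y
    ...   | inj₁ y<0 = contradiction 0<xy (<-asym (<-certificate (*-pos 0<x (x<y⇒0<y-x y<0))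
      (solve 2 (λ x y → con (+ 0) := x :* y :+ x :* (con (+ 0) :- y)) refl x y)))

    #0⇒0<² : ∀ {x} → x # 0# → 0# < x * x
    #0⇒0<² {x} x#0 with #⇒<⊎> x#0
    ... | inj₂ 0<x = *-pos 0<x 0<x
    ... | inj₁ x<0 = <-respʳ-≈ (solve 1 (λ x → (con (+ 0) :- x) :* (con (+ 0) :- x) := x :* x) refl x)
      (*-pos (x<y⇒0<y-x x<0) (x<y⇒0<y-x x<0))

    -- If the square were negative, `x < 0` would be impossible, since it makes the square positive;
    -- but then `0# ≤ x`, and the square is nonnegative after all.
    0≤² : ∀ x → 0# ≤ x * x
    0≤² x x²<0 = *-nonneg 0≤x 0≤x x²<0
      where
      0≤x : 0# ≤ x
      0≤x x<0 = <-asym x²<0 (#0⇒0<² (<⇒# x<0))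

    inverse : ∀ {x} → 0# < x → ∃ λ x⁻¹ → x * x⁻¹ ≈ 1#
    inverse {x} 0<x with #⇒invertible (#-sym (<⇒# 0<x))
    ... | x⁻¹ , _ , right = x⁻¹ , trans (*-congʳ (sym (trans (+-congˡ -0#≈0#) (+-identityʳ x)))) right
      where open RingProperties ring using (-0#≈0#)

    midpoint : ∀ {x y} → x < y → ∃ λ z → x < z × z < y
    midpoint {x} {y} x<y = (x + y) * ½ ,
      <-certificate 0<d (trans (solve 3 (λ x y h → (x :+ y) :* h := x :* (con (+ 2) :* h) :+ (y :- x) :* h) refl x y ½) (+-congʳ (whole x))) ,
      <-certificate 0<d (trans (sym (whole y)) (solve 3 (λ x y h → y :* (con (+ 2) :* h) := (x :+ y) :* h :+ (y :- x) :* h) refl x y ½))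
      where
      ½ = proj₁ (inverse (0<ι 2))
      2½≈1 : ι 2 * ½ ≈ 1#
      2½≈1 = proj₂ (inverse (0<ι 2))
      0<½ : 0# < ½
      0<½ = *-cancelˡ-pos (0<ι 2) (<-respʳ-≈ (trans (+-identityʳ 1#) (sym 2½≈1)) (0<ι 1))
      0<d : 0# < (y - x) * ½
      0<d = *-pos (x<y⇒0<y-x x<y) 0<½
      whole : ∀ z → z * (ι 2 * ½) ≈ z
      whole z = trans (*-congˡ 2½≈1) (*-identityʳ z)

    0≤ι : ∀ n → 0# ≤ ι n
    0≤ι zero    = ≤-refl
    0≤ι (suc n) = <⇒≤ (0<ι (suc n))

    ι-+ : ∀ m n → ι (m ℕ.+ n) ≈ ι m + ι n
    ι-+ = ×-homo-+ 1#

    ι-* : ∀ m n → ι (m ℕ.* n) ≈ ι m * ι n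
    ι-* = ×1-homo-*

    ι-mono-≤ : ∀ {m n} → m ℕ.≤ n → ι m ≤ ι n
    ι-mono-≤ {m} m≤n with ℕ.m≤n⇒∃[o]m+o≡n m≤n
    ... | k , ≡.refl = ≤-certificate (0≤ι k) (ι-+ m k)

    sum-cong : ∀ {n} {f g : Fin n → Carrier} → (∀ i → f i ≈ g i) → ∑ f ≈ ∑ g
    sum-cong = Sum.sum-cong-≋

    *-distribˡ-∑ : ∀ {n} a (f : Fin n → Carrier) → a * ∑ f ≈ ∑ (λ i → a * f i)
    *-distribˡ-∑ a f = Sum.*-distribˡ-sum a f

    sum-nonneg : ∀ {n} {f : Fin n → Carrier} → (∀ i → 0# ≤ f i) → 0# ≤ ∑ f
    sum-nonneg {zero}  0≤f = ≤-refl
    sum-nonneg {suc n} 0≤f = +-nonneg (0≤f zero) (sum-nonneg (0≤f ∘ suc))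

    sum-pos : ∀ {n} {f : Fin n → Carrier} → (∀ i → 0# ≤ f i) → ∀ i → 0# < f i → 0# < ∑ f
    sum-pos 0≤f zero    0<fi = +-pos-nonneg 0<fi (sum-nonneg (0≤f ∘ suc))
    sum-pos 0≤f (suc i) 0<fi = +-nonneg-pos (0≤f zero) (sum-pos (0≤f ∘ suc) i 0<fi)

    sum-mono-≤ : ∀ {n} {f g : Fin n → Carrier} → (∀ i → f i ≤ g i) → ∑ f ≤ ∑ g
    sum-mono-≤ {zero}  f≤g = ≤-refl
    sum-mono-≤ {suc n} {f} {g} f≤g = ≤-trans
      (≤-certificate (x≤y⇒0≤y-x (f≤g zero)) (solve 3 (λ a b s → b :+ s := a :+ s :+ (b :- a)) refl _ _ _))
      (≤-certificate (x≤y⇒0≤y-x (sum-mono-≤ (f≤g ∘ suc))) (solve 3 (λ a b s → s :+ b := s :+ a :+ (b :- a)) refl _ _ _))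

    -- Adding its transpose to each double sum turns the hypothesis into a termwise bound between
    -- the doubled sums. Doubling the assumed opposite inequality avoids a division by 2.
    ∑∑-transpose-≤ : ∀ {n} {f g : Fin n → Fin n → Carrier} →
      (∀ i j → f i j + f j i ≤ g i j + g j i) →
      ∑ (λ i → ∑ (f i)) ≤ ∑ (λ i → ∑ (g i))
    ∑∑-transpose-≤ {n} {f} {g} f≤g G<F = sum-mono-≤ (λ i → sum-mono-≤ (f≤g i))
      (<-respˡ-≈ (double g) (<-respʳ-≈ (double f)
        (<-trans (+-monoˡ-< _ G<F) (+-monoʳ-< _ G<F))))
      where
      double : ∀ h → ∑ (λ i → ∑ (h i)) + ∑ (λ i → ∑ (h i)) ≈ ∑ (λ i → ∑ (λ j → h i j + h j i))
      double h = begin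
        ∑ (λ i → ∑ (h i)) + ∑ (λ i → ∑ (h i))            ≈⟨ +-congˡ (∑-comm h) ⟩
        ∑ (λ i → ∑ (h i)) + ∑ (λ i → ∑ (λ j → h j i))    ≈⟨ ∑-distrib-+ (λ i → ∑ (h i)) _ ⟨
        ∑ (λ i → ∑ (h i) + ∑ (λ j → h j i))              ≈⟨ sum-cong (λ i → sym (∑-distrib-+ (h i) _)) ⟩
        ∑ (λ i → ∑ (λ j → h i j + h j i))                ∎
        where open ≈-Reasoning

-- Eigenvalue bounds from positive vectors, and roots of increasing cubics.

module RealAnalysis where
  open RealArithmetic
  open import Data.Fin using (Fin)
  open import Data.Integer using (+_)
  open import Data.Product using (∃; _×_; _,_; proj₁; proj₂)
  open import Data.Sum as Sum using (_⊎_; inj₁; [_,_]′)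
  open import Relation.Nullary using (¬_)

  module _ (ℝ : RealNumbers) where
    open OrderedField ℝ
    open ≈-Reasoning

    module WeightedBound {n} (A : Matrix ℝ n) (A-symm : ∀ i j → A i j ≈ A j i) (0≤A : ∀ i j → 0# ≤ A i j) where

      -- For an adjacency matrix this is `Qx`: the row sum that multiplies `x i` is the degree of
      -- `i`.
      action : (Fin n → Carrier) → Fin n → Carrier
      action x i = ∑ (λ j → A i j * (x i + x j))

      action-scale : ∀ a x i → ∑ (λ j → A i j * (a * x i + a * x j)) ≈ a * action x i
      action-scale a x i = trans
        (sum-cong (λ j → solve 4 (λ A a b c → A :* (a :* b :+ a :* c) := a :* (A :* (b :+ c))) refl (A i j) a (x i) (x j)))
        (sym (*-distribˡ-∑ {n} a _))

      -- With v = p x (pointwise), the two quadratic forms compared here differ by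
      -- half of ∑ᵢⱼ Aᵢⱼ xᵢ xⱼ (pᵢ - pⱼ)².
      eigenvalue-bound : ∀ x → (∀ i → 0# < x i) → ∀ {c L} → 0# ≤ c →
        (∀ i → c * action x i ≤ L * x i) →
        ∀ {μ} v → (∃ λ i → v i # 0#) → (∀ i → action v i ≈ μ * v i) → c * μ ≤ L
      eigenvalue-bound x 0<x {c} {L} 0≤c bound {μ} v (i₀ , vi₀#0) eigen L<cμ =
        cS≤LW (<-respʳ-≈ (sym cS) (<-certificate
          (*-pos (x<y⇒0<y-x L<cμ) 0<W)
          (solve 3 (λ L m W → m :* W := L :* W :+ (m :- L) :* W) refl L (c * μ) W)))
        where
        x⁻¹ : Fin n → Carrier
        x⁻¹ i = proj₁ (inverse (0<x i))

        p w : Fin n → Carrier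
        p i = v i * x⁻¹ i
        -- This is `v²/x`; pairing it with `c Qx ≤ L x` leaves `L ∑ v²` on the right.
        w i = p i * v i

        v≈px : ∀ i → v i ≈ p i * x i
        v≈px i = begin
          v i               ≈⟨ *-identityʳ _ ⟨
          v i * 1#          ≈⟨ *-congˡ (proj₂ (inverse (0<x i))) ⟨
          v i * (x i * x⁻¹ i) ≈⟨ solve 3 (λ v x i → v :* (x :* i) := v :* i :* x) refl (v i) (x i) (x⁻¹ i) ⟩
          p i * x i         ∎

        0≤w : ∀ i → 0# ≤ w i
        0≤w i = ≤-respʳ-≈
          (trans (*-assoc _ _ _) (*-congˡ (sym (v≈px i))))
          (*-nonneg (0≤² (p i)) (<⇒≤ (0<x i)))

        wx≈v² : ∀ i → w i * x i ≈ v i * v i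
        wx≈v² i = trans (solve 3 (λ p v x → p :* v :* x := v :* (p :* x)) refl (p i) (v i) (x i))
          (*-congˡ (sym (v≈px i)))

        W S : Carrier
        W = ∑ (λ i → v i * v i)
        S = ∑ (λ i → ∑ (λ j → A i j * (v i * v i + v i * v j)))

        0<W : 0# < W
        0<W = sum-pos (λ i → 0≤² (v i)) i₀ (#0⇒0<² vi₀#0)

        cS : c * S ≈ c * μ * W
        cS = begin
          c * S                             ≈⟨ *-congˡ (sum-cong (λ i → trans (action-scale (v i) v i) (*-congˡ (eigen i)))) ⟩
          c * ∑ (λ i → v i * (μ * v i))     ≈⟨ *-congˡ (sum-cong (λ i → solve 2 (λ v m → v :* (m :* v) := m :* (v :* v)) refl (v i) μ)) ⟩
          c * ∑ (λ i → μ * (v i * v i))     ≈⟨ *-congˡ (*-distribˡ-∑ {n} μ _) ⟨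
          c * (μ * W)                       ≈⟨ *-assoc _ _ _ ⟨
          c * μ * W                         ∎

        pairwise : ∀ i j → let s = λ i j → A i j * (v i * v i + v i * v j)
                               r = λ i j → A i j * (w i * x i + w i * x j)
                           in s i j + s j i ≤ r i j + r j i
        pairwise i j = ≤-certificate (*-nonneg (0≤A i j) (*-nonneg
            (*-nonneg (<⇒≤ (0<x i)) (<⇒≤ (0<x j))) (0≤² (p i - p j))))
          (begin
            A i j * (w i * x i + w i * x j) + A j i * (w j * x j + w j * x i)
              ≈⟨ +-cong (*-congˡ (+-congˡ (w* i j))) (*-cong (A-symm j i) (+-congˡ (w* j i))) ⟩
            A i j * (w i * x i + P * (P * X) * Y) + A i j * (w j * x j + R * (R * Y) * X)
              ≈⟨ +-cong (*-congˡ (+-congʳ (wx≈v² i))) (*-congˡ (+-congʳ (wx≈v² j))) ⟩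
            A i j * (v i * v i + P * (P * X) * Y) + A i j * (v j * v j + R * (R * Y) * X)
              ≈⟨ solve 7 (λ a b d P X R Y → a :* (b :+ P :* (P :* X) :* Y) :+ a :* (d :+ R :* (R :* Y) :* X)
                   := a :* (b :+ P :* X :* (R :* Y)) :+ a :* (d :+ R :* Y :* (P :* X)) :+ a :* (X :* Y :* ((P :- R) :* (P :- R))))
                   refl (A i j) (v i * v i) (v j * v j) P X R Y ⟩
            A i j * (v i * v i + P * X * (R * Y)) + A i j * (v j * v j + R * Y * (P * X)) + A i j * (X * Y * ((P - R) * (P - R)))
              ≈⟨ +-congʳ (+-cong (*-congˡ (+-congˡ (*-cong (v≈px i) (v≈px j))))
                                 (*-cong (A-symm j i) (+-congˡ (*-cong (v≈px j) (v≈px i))))) ⟨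
            A i j * (v i * v i + v i * v j) + A j i * (v j * v j + v j * v i) + A i j * (X * Y * ((P - R) * (P - R))) ∎)
          where
          P = p i
          X = x i
          R = p j
          Y = x j
          w* : ∀ i j → w i * x j ≈ p i * (p i * x i) * x j
          w* i j = *-congʳ (*-congˡ (v≈px i))

        cS≤LW : c * S ≤ L * W
        cS≤LW = ≤-trans (*-monoʳ-≤ 0≤c (∑∑-transpose-≤ pairwise))
          (≤-respˡ-≈ (begin
              ∑ (λ i → w i * (c * action x i))  ≈⟨ sum-cong (λ i → solve 3 (λ w c a → w :* (c :* a) := c :* (w :* a)) refl (w i) c (action x i)) ⟩
              ∑ (λ i → c * (w i * action x i))  ≈⟨ *-distribˡ-∑ {n} c _ ⟨
              c * ∑ (λ i → w i * action x i)    ≈⟨ *-congˡ (sum-cong (λ i → sym (action-scale (w i) x i))) ⟩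
              c * ∑ (λ i → ∑ (λ j → A i j * (w i * x i + w i * x j))) ∎)
            (≤-respʳ-≈ (begin
              ∑ (λ i → w i * (L * x i))         ≈⟨ sum-cong (λ i → trans (solve 3 (λ w L x → w :* (L :* x) := L :* (w :* x)) refl (w i) L (x i)) (*-congˡ (wx≈v² i))) ⟩
              ∑ (λ i → L * (v i * v i))         ≈⟨ *-distribˡ-∑ {n} L _ ⟨
              L * W                             ∎)
            (sum-mono-≤ (λ i → *-monoʳ-≤ (0≤w i) (bound i)))))

    module IncreasingCubic (α β : Carrier) (0≤α : 0# ≤ α) (0≤β : 0# ≤ β) where

      h : Carrier → Carrier
      h s = s * s * s + α * (s * s) + β * s

      -- The divided difference of `h` between `s` and `s + t`. Its positivity makes `h` increasing,
      -- and an upper bound for it is a Lipschitz constant.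
      slope : Carrier → Carrier → Carrier
      slope s t = ι 3 * (s * s) + ι 3 * (s * t) + t * t + α * (ι 2 * s + t) + β

      h-+ : ∀ s t → h (s + t) ≈ h s + t * slope s t
      h-+ s t = solve 4 (λ a b s t →
        (s :+ t) :* (s :+ t) :* (s :+ t) :+ a :* ((s :+ t) :* (s :+ t)) :+ b :* (s :+ t)
        := s :* s :* s :+ a :* (s :* s) :+ b :* s :+ t :* (con (+ 3) :* (s :* s) :+ con (+ 3) :* (s :* t) :+ t :* t :+ a :* (con (+ 2) :* s :+ t) :+ b))
        refl α β s t

      h-cong : ∀ {s t} → s ≈ t → h s ≈ h t
      h-cong s≈t = +-cong (+-cong (*-cong (*-cong s≈t s≈t) s≈t) (*-congˡ (*-cong s≈t s≈t))) (*-congˡ s≈t)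

      h-mono-< : ∀ {s t} → 0# ≤ s → s < t → h s < h t
      h-mono-< {s} {t} 0≤s s<t = <-certificate (*-pos 0<d 0<slope)
        (trans (h-cong (solve 2 (λ s t → t := s :+ (t :- s)) refl s t)) (h-+ s (t - s)))
        where
        0<d = x<y⇒0<y-x s<t
        0≤d = <⇒≤ 0<d
        0<slope : 0# < slope s (t - s)
        0<slope = +-pos-nonneg (+-pos-nonneg (+-nonneg-pos
          (+-nonneg (*-nonneg (0≤ι 3) (0≤² s)) (*-nonneg (0≤ι 3) (*-nonneg 0≤s 0≤d)))
          (*-pos 0<d 0<d))
          (*-nonneg 0≤α (+-nonneg (*-nonneg (0≤ι 2) 0≤s) 0≤d))) 0≤β

      -- The value of `slope` at `s = t = 1`, hence its maximum on the unit square.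
      C : Carrier
      C = ι 7 + ι 3 * α + β

      0<C : 0# < C
      0<C = +-pos-nonneg (+-pos-nonneg (0<ι 7) (*-nonneg (0≤ι 3) 0≤α)) 0≤β

      slope≤C : ∀ {s t} → 0# ≤ s → s ≤ 1# → 0# ≤ t → t ≤ 1# → slope s t ≤ C
      slope≤C {s} {t} 0≤s s≤1 0≤t t≤1 = ≤-respʳ-≈ C≈ (≤-certificate
        (+-nonneg (+-nonneg (+-nonneg
          (*-nonneg (0≤ι 3) (*-nonneg 0≤1-s (+-nonneg 0≤1 0≤s)))
          (*-nonneg (0≤ι 3) (+-nonneg 0≤1-s (*-nonneg 0≤s 0≤1-t))))
          (*-nonneg 0≤1-t (+-nonneg 0≤1 0≤t)))
          (*-nonneg 0≤α (+-nonneg (*-nonneg (0≤ι 2) 0≤1-s) 0≤1-t))) refl)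
        where
        0≤1 = ≤-respʳ-≈ (+-identityʳ 1#) (0≤ι 1)
        0≤1-s = x≤y⇒0≤y-x s≤1
        0≤1-t = x≤y⇒0≤y-x t≤1
        one : ι 1 ≈ 1#
        one = +-identityʳ 1#
        C≈ : slope s t + (ι 3 * ((1# - s) * (1# + s)) + ι 3 * ((1# - s) + s * (1# - t)) + (1# - t) * (1# + t) + α * (ι 2 * (1# - s) + (1# - t))) ≈ C
        C≈ = begin
          slope s t + (ι 3 * ((1# - s) * (1# + s)) + ι 3 * ((1# - s) + s * (1# - t)) + (1# - t) * (1# + t) + α * (ι 2 * (1# - s) + (1# - t)))
            ≈⟨ +-congˡ (+-cong (+-cong (+-cong
                 (*-congˡ (*-cong (+-congʳ one) (+-congʳ one)))
                 (*-congˡ (+-cong (+-congʳ one) (*-congˡ (+-congʳ one)))))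
                 (*-cong (+-congʳ one) (+-congʳ one)))
                 (*-congˡ (+-cong (*-congˡ (+-congʳ one)) (+-congʳ one)))) ⟨
          slope s t + (ι 3 * ((ι 1 - s) * (ι 1 + s)) + ι 3 * ((ι 1 - s) + s * (ι 1 - t)) + (ι 1 - t) * (ι 1 + t) + α * (ι 2 * (ι 1 - s) + (ι 1 - t)))
            ≈⟨ solve 4 (λ a b s t → con (+ 3) :* (s :* s) :+ con (+ 3) :* (s :* t) :+ t :* t :+ a :* (con (+ 2) :* s :+ t) :+ b
                 :+ (con (+ 3) :* ((con (+ 1) :- s) :* (con (+ 1) :+ s)) :+ con (+ 3) :* ((con (+ 1) :- s) :+ s :* (con (+ 1) :- t))
                     :+ (con (+ 1) :- t) :* (con (+ 1) :+ t) :+ a :* (con (+ 2) :* (con (+ 1) :- s) :+ (con (+ 1) :- t)))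
                 := con (+ 7) :+ con (+ 3) :* a :+ b) refl α β s t ⟩
          C ∎

      module _ {γ : Carrier} (0<γ : 0# < γ) (γ<h1 : γ < h (ι 1)) where

        Below : Carrier → Set
        Below s = 0# ≤ s × h s < γ

        0∈Below : Below 0#
        0∈Below = ≤-refl , <-respˡ-≈
          (solve 2 (λ a b → con (+ 0) := con (+ 0) :* con (+ 0) :* con (+ 0) :+ a :* (con (+ 0) :* con (+ 0)) :+ b :* con (+ 0)) refl α β) 0<γ

        γ≤h⇒upper : ∀ {b} → 0# ≤ b → γ ≤ h b → b IsUpperBoundOf Below
        γ≤h⇒upper 0≤b γ≤hb x (0≤x , hx<γ) b<x = γ≤hb (<-trans (h-mono-< 0≤b b<x) hx<γ)

        -- Cotransitivity of `h c < h b` at `γ`, for a point `c` between `a` and `b`, either puts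
        -- `c` in the set or makes `b` an upper bound. The position of 0 is settled first because
        -- `h` is known to increase only on nonnegative arguments.
        located : Located Below
        located {a} {b} a<b = locate (midpoint a<b)
          where
          locate : (∃ λ c → a < c × c < b) → (∃ λ x → Below x × a < x) ⊎ b IsUpperBoundOf Below
          locate (c , a<c , c<b) = [ (λ a<0 → inj₁ (0# , 0∈Below , a<0)) , compare ]′ (<-cotrans a<c 0#)
            where
            compare : 0# < c → (∃ λ x → Below x × a < x) ⊎ b IsUpperBoundOf Below
            compare 0<c = Sum.map
              (λ hc<γ → c , (<⇒≤ 0<c , hc<γ) , a<c)
              (λ γ<hb → γ≤h⇒upper (<⇒≤ (<-trans 0<c c<b)) (<⇒≤ γ<hb))
              (<-cotrans (h-mono-< (<⇒≤ 0<c) c<b) γ)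

        -- An intermediate value theorem: a gap between `h s` and `γ`, divided by a Lipschitz
        -- constant, gives a shift of `s` that contradicts its being the supremum. The hypothesis
        -- `γ<h1` keeps `s` in the unit interval, where `C` is such a constant.
        root : ∃ λ s → 0# ≤ s × h s ≈ γ
        root = s , 0≤s , ≤-antisym hs≤γ γ≤hs
          where
          sup = supremum Below (0# , 0∈Below) (ι 1 , γ≤h⇒upper (0≤ι 1) (<⇒≤ γ<h1)) located
          s = proj₁ sup
          upper = proj₁ (proj₂ sup)
          approach = proj₂ (proj₂ sup)

          0≤s : 0# ≤ s
          0≤s = upper 0# 0∈Below

          s≤1 : s ≤ 1#
          s≤1 1<s = absurd (approach (<-respˡ-≈ (sym (+-identityʳ 1#)) 1<s))
            where
            absurd : ¬ (∃ λ x → Below x × ι 1 < x)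
            absurd (x , (_ , hx<γ) , 1<x) = <-asym γ<h1 (<-trans (h-mono-< (0≤ι 1) 1<x) hx<γ)

          hs≤γ : h s ≤ γ
          hs≤γ γ<hs = absurd (approach (<-certificate 0<δ (solve 2 (λ s d → s := (s :- d) :+ d) refl s δ)))
            where
            C⁻¹ = proj₁ (inverse 0<C)
            CC⁻¹≈1 = proj₂ (inverse 0<C)
            -- A member `x` of `Below` within `δ` of `s` would give `h s < γ + C δ`, whose right
            -- side is `h s` itself.
            δ = (h s - γ) * C⁻¹
            Cδ : C * δ ≈ h s - γ
            Cδ = trans (solve 3 (λ C e i → C :* (e :* i) := e :* (C :* i)) refl C (h s - γ) C⁻¹) (trans (*-congˡ CC⁻¹≈1) (*-identityʳ _))
            0<δ : 0# < δ
            0<δ = *-cancelˡ-pos 0<C (<-respʳ-≈ (sym Cδ) (x<y⇒0<y-x γ<hs))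
            absurd : ¬ (∃ λ x → Below x × s - δ < x)
            absurd (x , (0≤x , hx<γ) , s-δ<x) = ≤-refl (<-≤-trans
              (<-respˡ-≈ (h-cong (solve 2 (λ s x → x :+ (s :- x) := s) refl s x))
                (≤-<-trans (≤-reflexive (h-+ x t))
                (<-≤-trans (+-monoˡ-< (t * slope x t) hx<γ)
                (≤-trans (≤-certificate (*-nonneg 0≤t (x≤y⇒0≤y-x (slope≤C 0≤x x≤1 0≤t t≤1)))
                    (solve 4 (λ g t k C → g :+ C :* t := g :+ t :* k :+ t :* (C :- k)) refl γ t (slope x t) C))
                  (≤-certificate (*-nonneg (<⇒≤ 0<C) (x≤y⇒0≤y-x t≤δ))
                    (solve 4 (λ g C t d → g :+ C :* d := g :+ C :* t :+ C :* (d :- t)) refl γ C t δ))))))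
              (≤-reflexive (trans (+-congˡ Cδ) (solve 2 (λ g e → g :+ (e :- g) := e) refl γ (h s)))))
              where
              t = s - x
              0≤t : 0# ≤ t
              0≤t = x≤y⇒0≤y-x (upper x (0≤x , hx<γ))
              x≤1 : x ≤ 1#
              x≤1 = ≤-trans (upper x (0≤x , hx<γ)) s≤1
              t≤1 : t ≤ 1#
              t≤1 = ≤-trans (≤-certificate 0≤x (solve 2 (λ s x → s := (s :- x) :+ x) refl s x)) s≤1
              t≤δ : t ≤ δ
              t≤δ = ≤-certificate (<⇒≤ (x<y⇒0<y-x s-δ<x))
                (solve 3 (λ s x d → d := (s :- x) :+ (x :- (s :- d))) refl s x δ)

          γ≤hs : γ ≤ h s
          γ≤hs hs<γ = upper (s + δ) (+-nonneg 0≤s (<⇒≤ 0<δ) , hs+δ<γ) (<-certificate 0<δ refl)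
            where
            e = γ - h s
            0<e = x<y⇒0<y-x hs<γ
            i = proj₁ (inverse (+-pos 0<C 0<e))
            inv = proj₂ (inverse (+-pos 0<C 0<e))
            -- This is `e / (C + e)`: the summand `e` in the denominator ensures both `δ ≤ 1`, where
            -- the bound `C` is valid, and `C δ < e`.
            δ = e * i
            [C+e]δ : (C + e) * δ ≈ e
            [C+e]δ = trans (solve 3 (λ C e i → C :* (e :* i) := e :* (C :* i)) refl (C + e) e i) (trans (*-congˡ inv) (*-identityʳ _))
            0<δ : 0# < δ
            0<δ = *-cancelˡ-pos (+-pos 0<C 0<e) (<-respʳ-≈ (sym [C+e]δ) 0<e)
            δ≤1 : δ ≤ 1#
            δ≤1 = ≤-respʳ-≈ (+-identityʳ 1#) (≤-certificate (<⇒≤ 0<1-δ) (solve 1 (λ d → con (+ 1) := d :+ (con (+ 1) :- d)) refl δ))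
              where
              0<1-δ : 0# < ι 1 - δ
              0<1-δ = *-cancelˡ-pos (+-pos 0<C 0<e) (<-respʳ-≈ (begin
                C                             ≈⟨ solve 2 (λ C e → C := (C :+ e) :- e) refl C e ⟩
                C + e - e                     ≈⟨ +-congˡ (-‿cong [C+e]δ) ⟨
                C + e - (C + e) * δ           ≈⟨ solve 2 (λ a d → a :- a :* d := a :* (con (+ 1) :- d)) refl (C + e) δ ⟩
                (C + e) * (ι 1 - δ)           ∎) 0<C)
            hs+δ<γ : h (s + δ) < γ
            hs+δ<γ = ≤-<-trans (≤-reflexive (h-+ s δ)) (≤-<-trans
              (≤-certificate (*-nonneg (<⇒≤ 0<δ) (x≤y⇒0≤y-x (slope≤C 0≤s s≤1 (<⇒≤ 0<δ) δ≤1)))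
                (solve 4 (λ g t k C → g :+ C :* t := g :+ t :* k :+ t :* (C :- k)) refl (h s) δ (slope s δ) C))
              (<-certificate (*-pos 0<e 0<δ) (begin
                γ                               ≈⟨ solve 2 (λ g z → g := z :+ (g :- z)) refl γ (h s) ⟩
                h s + e                         ≈⟨ +-congˡ [C+e]δ ⟨
                h s + (C + e) * δ               ≈⟨ solve 4 (λ z C e d → z :+ (C :+ e) :* d := z :+ C :* d :+ e :* d) refl (h s) C e δ ⟩
                h s + C * δ + e * δ             ∎)))

-- Factorisation of the quartic and a lower bound for its largest root.

module QuarticRoots where
  open RealArithmetic
  open RealAnalysis
  open import Data.Integer using (+_)
  open import Data.Nat as ℕ using (ℕ)
  open import Data.Nat.Tactic.RingSolver using (solve-∀)
  open import Data.Product using (_,_; proj₁; proj₂)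
  open import Relation.Binary.PropositionalEquality as ≡ using (_≡_)

  module _ (ℝ : RealNumbers) where
    open OrderedField ℝ
    open ≈-Reasoning

    -- Here κ = k - 1, so that m = 3κ + 4.
    module LargestRoot (κ : ℕ) where

      y : Carrier
      y = ι (1 ℕ.+ 2 ℕ.* κ)

      -- With `u = q - 2`, the equation `u * cubic u = 0` is the eigenvalue equation at the centre
      -- of the graph H after the other rows have been solved.
      cubic : Carrier → Carrier
      cubic u = (u - y) * (u * u - ι 2) - ι 2 * (u - ι 1)

      ι-affine : ∀ a b → ι (a ℕ.* κ ℕ.+ b) ≈ ι a * ι κ + ι b
      ι-affine a b = trans (ι-+ (a ℕ.* κ) b) (+-congʳ (ι-* a κ))

      y≈ : y ≈ ι 1 + ι 2 * ι κ
      y≈ = trans (ι-+ 1 (2 ℕ.* κ)) (+-congˡ (ι-* 2 κ))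

      quartic-factor : ∀ x → quartic ℝ (3 ℕ.* κ ℕ.+ 4) x ≈ (x - ι 2) * cubic (x - ι 2)
      quartic-factor x = begin
        quartic ℝ m x
          ≈⟨ +-cong (+-cong (+-cong (+-congˡ (-‿cong (*-congʳ (*-congʳ
               (coefficient 6 27 (eq1 κ)))))) (*-congʳ
               (coefficient 12 26 (eq2 κ))))
               (-‿cong (*-congʳ (*-congˡ (+-congʳ (coefficient 15 20 (eq3 κ))))))) (*-congˡ (+-congʳ (coefficient 3 4 ≡.refl))) ⟩
        x ^ 4 - (ι 6 * K + ι 27) * i * x ^ 3 + (ι 12 * K + ι 26) * x ^ 2
          - ι 4 * i * ((ι 15 * K + ι 20) - ι 2) * x + ι 8 * i * ((ι 3 * K + ι 4) - ι 4)
          -- The solver sees `i`, the inverse of 3, as a free variable, so the two polynomials agree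
          -- only up to a multiple of `3i - 1`. That multiple is written out here and vanishes in
          -- the next step.
          ≈⟨ solve 3 (λ x K i →
               x :^ 4 :- (con (+ 6) :* K :+ con (+ 27)) :* i :* x :^ 3 :+ (con (+ 12) :* K :+ con (+ 26)) :* x :^ 2
                 :- con (+ 4) :* i :* ((con (+ 15) :* K :+ con (+ 20)) :- con (+ 2)) :* x :+ con (+ 8) :* i :* ((con (+ 3) :* K :+ con (+ 4)) :- con (+ 4))
               := (let u = x :- con (+ 2) ; y = con (+ 1) :+ con (+ 2) :* K in
                   u :* ((u :- y) :* (u :* u :- con (+ 2)) :- con (+ 2) :* (u :- con (+ 1))))
                 :+ (con (+ 3) :* i :- con (+ 1)) :*
                    (con (+ 8) :* K :- (con (+ 2) :* K :+ con (+ 9)) :* x :^ 3 :- con (+ 4) :* (con (+ 5) :* K :+ con (+ 6)) :* x))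
               refl x K i ⟩
        u * ((u - (ι 1 + ι 2 * K)) * (u * u - ι 2) - ι 2 * (u - ι 1)) + (ι 3 * i - ι 1) * R
          ≈⟨ +-cong (*-congˡ (+-congʳ (*-congʳ (+-congˡ (-‿cong (sym y≈)))))) (trans (*-congʳ 3i-1≈0) (zeroˡ R)) ⟩
        u * cubic u + 0#
          ≈⟨ +-identityʳ _ ⟩
        u * cubic u ∎
        where
        eq1 : ∀ κ → 2 ℕ.* (3 ℕ.* κ ℕ.+ 4) ℕ.+ 19 ≡ 6 ℕ.* κ ℕ.+ 27
        eq1 = solve-∀
        eq2 : ∀ κ → 4 ℕ.* (3 ℕ.* κ ℕ.+ 4) ℕ.+ 10 ≡ 12 ℕ.* κ ℕ.+ 26
        eq2 = solve-∀
        eq3 : ∀ κ → 5 ℕ.* (3 ℕ.* κ ℕ.+ 4) ≡ 15 ℕ.* κ ℕ.+ 20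
        eq3 = solve-∀
        m = 3 ℕ.* κ ℕ.+ 4
        K = ι κ
        u = x - ι 2
        R = ι 8 * K - (ι 2 * K + ι 9) * x ^ 3 - ι 4 * (ι 5 * K + ι 6) * x
        i = proj₁ (#⇒invertible {ι 3} {0#} (#-sym (<⇒# (0<ι 3))))
        3i-1≈0 : ι 3 * i - ι 1 ≈ 0#
        3i-1≈0 = begin
          ι 3 * i - ι 1         ≈⟨ +-cong (solve 1 (λ i → con (+ 3) :* i := (con (+ 3) :- con (+ 0)) :* i) refl i) (-‿cong (+-identityʳ 1#)) ⟩
          (ι 3 - 0#) * i - 1#   ≈⟨ +-congʳ (proj₂ (proj₂ (#⇒invertible {ι 3} {0#} (#-sym (<⇒# (0<ι 3)))))) ⟩
          1# - 1#               ≈⟨ -‿inverseʳ 1# ⟩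
          0#                    ∎
        coefficient : ∀ a b {n} → n ≡ a ℕ.* κ ℕ.+ b → ι n ≈ ι a * K + ι b
        coefficient a b ≡.refl = ι-affine a b

      module _ (1≤κ : 1 ℕ.≤ κ) where
        2<y : ι 2 < y
        2<y = <-≤-trans (<-certificate (0<ι 1) (ι-+ 2 1)) (ι-mono-≤ (ℕ.s≤s (ℕ.*-monoʳ-≤ 2 1≤κ)))
          where import Data.Nat.Properties as ℕ

        0<y : 0# < y
        0<y = <-trans (0<ι 2) 2<y

        private
          z = y - ι 2
          0<z = x<y⇒0<y-x 2<y
          0≤z = <⇒≤ 0<z
          0≤y = <⇒≤ 0<y
          α = ι 2 * y
          β = y * y - ι 4
          γ = ι 2 * (y - ι 1)

          0≤β : 0# ≤ β
          0≤β = ≤-respʳ-≈ (solve 1 (λ y → (y :- con (+ 2)) :* (y :+ con (+ 2)) := y :* y :- con (+ 4)) refl y)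
            (*-nonneg 0≤z (+-nonneg 0≤y (0≤ι 2)))

          open IncreasingCubic ℝ α β (*-nonneg (0≤ι 2) 0≤y) 0≤β using (h; root)

          0<γ : 0# < γ
          0<γ = *-pos (0<ι 2) (<-respʳ-≈ (solve 1 (λ y → (y :- con (+ 2)) :+ con (+ 1) := y :- con (+ 1)) refl y)
            (+-pos 0<z (0<ι 1)))

          γ<h1 : γ < h (ι 1)
          γ<h1 = <-certificate (+-pos (*-pos 0<z (+-pos 0<y (0<ι 2))) (0<ι 3))
            (solve 1 (λ y → con (+ 1) :* con (+ 1) :* con (+ 1) :+ con (+ 2) :* y :* (con (+ 1) :* con (+ 1)) :+ (y :* y :- con (+ 4)) :* con (+ 1)
              := con (+ 2) :* (y :- con (+ 1)) :+ ((y :- con (+ 2)) :* (y :+ con (+ 2)) :+ con (+ 3))) refl y)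

          s = proj₁ (root 0<γ γ<h1)
          0≤s : 0# ≤ s
          0≤s = proj₁ (proj₂ (root 0<γ γ<h1))
          hs≈γ : h s ≈ γ
          hs≈γ = proj₂ (proj₂ (root 0<γ γ<h1))

          r = y * s
          0≤r = *-nonneg 0≤y 0≤s

          -- The cubic is negative at s = 1/y.
          0<r-1 : 0# < r - ι 1
          0<r-1 = *-cancelˡ-pos {P} 0<P (<-respʳ-≈ (sym P[r-1])
            (+-pos-nonneg (+-pos (*-pos (*-pos (*-pos 0<y 0<y) 0<y) 0<z) (*-pos 0<y 0<y))
              (+-nonneg (*-nonneg 0≤z (+-nonneg 0≤y (0≤ι 2))) (0≤ι 3))))
            where
            -- Chosen so that `P (r - 1)` is `y³ (h s - h (1/y))`; the factor `y³` clears the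
            -- inverses of `y`.
            P = r * r + r + ι 2 * (y * y) * (r + ι 1) + (y * y - ι 4) * (y * y) + ι 1
            0<P : 0# < P
            0<P = +-nonneg-pos (+-nonneg (+-nonneg (+-nonneg (0≤² r) 0≤r)
              (*-nonneg (*-nonneg (0≤ι 2) (0≤² y)) (+-nonneg 0≤r (0≤ι 1)))) (*-nonneg 0≤β (0≤² y))) (0<ι 1)
            P[r-1] : P * (r - ι 1) ≈ y * y * y * z + y * y + (z * (y + ι 2) + ι 3)
            P[r-1] = begin
              P * (r - ι 1)
                ≈⟨ solve 2 (λ y s → let r = y :* s in
                     (r :* r :+ r :+ con (+ 2) :* (y :* y) :* (r :+ con (+ 1)) :+ (y :* y :- con (+ 4)) :* (y :* y) :+ con (+ 1)) :* (r :- con (+ 1))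
                     := y :* y :* y :* (s :* s :* s :+ con (+ 2) :* y :* (s :* s) :+ (y :* y :- con (+ 4)) :* s)
                        :- (y :* y :* y :* y :- con (+ 2) :* (y :* y) :+ con (+ 1))) refl y s ⟩
              y * y * y * h s - (y * y * y * y - ι 2 * (y * y) + ι 1)
                ≈⟨ +-congʳ (*-congˡ hs≈γ) ⟩
              y * y * y * γ - (y * y * y * y - ι 2 * (y * y) + ι 1)
                ≈⟨ solve 1 (λ y → y :* y :* y :* (con (+ 2) :* (y :- con (+ 1))) :- (y :* y :* y :* y :- con (+ 2) :* (y :* y) :+ con (+ 1))
                     := y :* y :* y :* (y :- con (+ 2)) :+ y :* y :+ ((y :- con (+ 2)) :* (y :+ con (+ 2)) :+ con (+ 3))) refl y ⟩
              y * y * y * z + y * y + (z * (y + ι 2) + ι 3) ∎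

          0<s : 0# < s
          0<s = *-cancelˡ-pos 0<y (<-trans (0<ι 1) (<-certificate 0<r-1 (solve 1 (λ r → r := con (+ 1) :+ (r :- con (+ 1))) refl r)))

          x₀ = ι 2 + (y + s)

          quartic-x₀ : quartic ℝ (3 ℕ.* κ ℕ.+ 4) x₀ ≈ 0#
          quartic-x₀ = begin
            quartic ℝ (3 ℕ.* κ ℕ.+ 4) x₀      ≈⟨ quartic-factor x₀ ⟩
            (x₀ - ι 2) * cubic (x₀ - ι 2)
              ≈⟨ solve 2 (λ y s → let u = con (+ 2) :+ (y :+ s) :- con (+ 2) in
                   u :* ((u :- y) :* (u :* u :- con (+ 2)) :- con (+ 2) :* (u :- con (+ 1)))
                   := (y :+ s) :* (s :* s :* s :+ con (+ 2) :* y :* (s :* s) :+ (y :* y :- con (+ 4)) :* s :- con (+ 2) :* (y :- con (+ 1)))) refl y s ⟩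
            (y + s) * (h s - γ)               ≈⟨ *-congˡ (trans (+-congʳ hs≈γ) (-‿inverseʳ γ)) ⟩
            (y + s) * 0#                      ≈⟨ zeroʳ _ ⟩
            0#                                ∎

        module _ {q} (q-largest : IsLargestRoot ℝ (3 ℕ.* κ ℕ.+ 4) q) where
          private
            x₀≤q : x₀ ≤ q
            x₀≤q = proj₂ q-largest x₀ quartic-x₀

          y<q-2 : y < q - ι 2
          y<q-2 = <-≤-trans (<-certificate 0<s refl) (≤-certificate (x≤y⇒0≤y-x x₀≤q)
            (solve 3 (λ y s q → q :- con (+ 2) := y :+ s :+ (q :- (con (+ 2) :+ (y :+ s)))) refl y s q))

          -- The largest root is not the root 2 of the linear factor: `q - 2` exceeds `y > 0`, so
          -- that factor cancels.
          cubic-root : cubic (q - ι 2) ≈ 0#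
          cubic-root = begin
            cubic u             ≈⟨ *-identityˡ _ ⟨
            1# * cubic u        ≈⟨ *-congʳ (proj₂ (inverse 0<u)) ⟨
            u * u⁻¹ * cubic u   ≈⟨ solve 3 (λ u i c → u :* i :* c := i :* (u :* c)) refl u u⁻¹ (cubic u) ⟩
            u⁻¹ * (u * cubic u) ≈⟨ *-congˡ (trans (sym (quartic-factor q)) (proj₁ q-largest)) ⟩
            u⁻¹ * 0#            ≈⟨ zeroʳ _ ⟩
            0#                  ∎
            where
            u = q - ι 2
            0<u = <-trans 0<y y<q-2
            u⁻¹ = proj₁ (inverse 0<u)

          [1+y]²<yq : (ι 1 + y) * (ι 1 + y) < y * q
          [1+y]²<yq = <-≤-trans
            (<-certificate 0<r-1 (solve 2 (λ y s → y :* (con (+ 2) :+ (y :+ s)) := (con (+ 1) :+ y) :* (con (+ 1) :+ y) :+ (y :* s :- con (+ 1))) refl y s))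
            (*-monoʳ-≤ 0≤y x₀≤q)

-- Counting by sums of indicators, and the handshake identity.

module GraphCounting where
  import Algebra.Properties.Semiring.Sum as SumProperties
  open import Data.Bool using (if_then_else_)
  open import Data.Fin using (Fin; zero; suc; _≟_; _<?_)
  import Data.Fin as Fin
  import Data.Fin.Properties as Fin
  open import Data.List using (List; []; _∷_; map; length; filter; tabulate; cartesianProduct; _++_)
  import Data.List.Properties as List
  open import Data.List.Relation.Unary.All as All using (All; []; _∷_)
  open import Data.List.Relation.Unary.AllPairs using ([]; _∷_)
  open import Data.List.Relation.Unary.Unique.Propositional using (Unique)
  open import Data.Nat using (ℕ; zero; suc; _+_; _*_; _≤_; _<_; z≤n; s≤s; s≤s⁻¹)
  open import Data.Nat.ListAction using () renaming (sum to listSum)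
  open import Data.Nat.Properties hiding (_≟_; _<?_)
  open import Data.Product using (∃; ∃₂; _×_; _,_; proj₁; proj₂)
  open import Function using (_∘_; id)
  open import Relation.Binary using (tri<; tri≈; tri>)
  open import Relation.Binary.PropositionalEquality
  open import Relation.Nullary using (¬_; Dec; yes; no; does; contradiction)
  open import Relation.Nullary.Decidable using (_×-dec_; ¬?)
  open import Relation.Unary using (Pred; Decidable)
  open import Level using (0ℓ)

  open SumProperties +-*-semiring public using (sum; sum-cong-≗; ∑-distrib-+; ∑-comm; *-distribˡ-sum)

  𝟙 : {P : Set} → Dec P → ℕ
  𝟙 P? = if does P? then 1 else 0

  𝟙≤1 : ∀ {P : Set} (P? : Dec P) → 𝟙 P? ≤ 1
  𝟙≤1 (yes _) = s≤s z≤n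
  𝟙≤1 (no _)  = z≤n

  𝟙-yes : ∀ {P : Set} (P? : Dec P) → P → 𝟙 P? ≡ 1
  𝟙-yes (yes _) p = refl
  𝟙-yes (no ¬p) p = contradiction p ¬p

  𝟙-no : ∀ {P : Set} (P? : Dec P) → ¬ P → 𝟙 P? ≡ 0
  𝟙-no (yes p) ¬p = contradiction p ¬p
  𝟙-no (no _)  ¬p = refl

  1≤𝟙⇒ : ∀ {P : Set} (P? : Dec P) → 1 ≤ 𝟙 P? → P
  1≤𝟙⇒ (yes p) _ = p

  𝟙-cong : ∀ {P Q : Set} (P? : Dec P) (Q? : Dec Q) → (P → Q) → (Q → P) → 𝟙 P? ≡ 𝟙 Q?
  𝟙-cong (yes p) Q? P⇒Q Q⇒P = sym (𝟙-yes Q? (P⇒Q p))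
  𝟙-cong (no ¬p) Q? P⇒Q Q⇒P = sym (𝟙-no Q? (¬p ∘ Q⇒P))

  𝟙-*-mono : ∀ {P : Set} (P? : Dec P) {a b} → (P → a ≤ b) → 𝟙 P? * a ≤ 𝟙 P? * b
  𝟙-*-mono (yes p) a≤b = *-monoʳ-≤ 1 (a≤b p)
  𝟙-*-mono (no _)  a≤b = z≤n

  1≤𝟙-*⇒ : ∀ {P : Set} (P? : Dec P) {a} → 1 ≤ 𝟙 P? * a → P
  1≤𝟙-*⇒ (yes p) _ = p

  sum-mono : ∀ {n} {f g : Fin n → ℕ} → (∀ i → f i ≤ g i) → sum f ≤ sum g
  sum-mono {zero}  f≤g = z≤n
  sum-mono {suc n} f≤g = +-mono-≤ (f≤g zero) (sum-mono (f≤g ∘ suc))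

  sum-zero : ∀ {n} {f : Fin n → ℕ} → (∀ i → f i ≡ 0) → sum f ≡ 0
  sum-zero {zero}  f≡0 = refl
  sum-zero {suc n} f≡0 = cong₂ _+_ (f≡0 zero) (sum-zero (f≡0 ∘ suc))

  sum-ones : ∀ n → sum {n} (λ _ → 1) ≡ n
  sum-ones zero    = refl
  sum-ones (suc n) = cong suc (sum-ones n)

  sum-single : ∀ {n} (f : Fin n → ℕ) i → sum (λ j → 𝟙 (j ≟ i) * f j) ≡ f i
  sum-single {suc n} f zero    = trans (cong₂ _+_ (+-identityʳ (f zero)) (sum-zero {n} (λ _ → refl))) (+-identityʳ _)
  sum-single {suc n} f (suc i) = sum-single (f ∘ suc) i

  -- The induction varies `f`: the head `x` is split off by setting the function to 0 there, which
  -- leaves its values on the tail unchanged.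
  sum-unique-≤ : ∀ {n} (f : Fin n → ℕ) {xs} → Unique xs → listSum (map f xs) ≤ sum f
  sum-unique-≤ f []                    = z≤n
  sum-unique-≤ {n} f (_∷_ {x} {xs} x∉xs unique) = begin
    f x + listSum (map f xs)                      ≡⟨ cong (λ l → f x + listSum l) (map-cong x∉xs) ⟩
    f x + listSum (map g xs)                      ≤⟨ +-monoʳ-≤ (f x) (sum-unique-≤ g unique) ⟩
    f x + sum g                                   ≡⟨ cong (_+ sum g) (sum-single f x) ⟨
    sum (λ j → 𝟙 (j ≟ x) * f j) + sum g           ≡⟨ ∑-distrib-+ {n} _ g ⟨
    sum (λ j → 𝟙 (j ≟ x) * f j + g j)             ≡⟨ sum-cong-≗ split ⟩
    sum f                                         ∎
    where
    open ≤-Reasoning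
    g : Fin n → ℕ
    g j = 𝟙 (¬? (j ≟ x)) * f j
    split : ∀ j → 𝟙 (j ≟ x) * f j + g j ≡ f j
    split j with j ≟ x
    ... | yes _ = trans (+-identityʳ _) (+-identityʳ _)
    ... | no _  = +-identityʳ _
    map-cong : ∀ {ys} → All (x ≢_) ys → map f ys ≡ map g ys
    map-cong []                       = refl
    map-cong (_∷_ {y} x≢y x∉ys) = cong₂ _∷_
      (sym (trans (cong (_* f y) (𝟙-yes (¬? (y ≟ x)) (x≢y ∘ sym))) (+-identityʳ _))) (map-cong x∉ys)

  sum-positive : ∀ {n} (f : Fin n → ℕ) → 1 ≤ sum f → ∃ λ i → 1 ≤ f i
  sum-positive {suc n} f 1≤ with f zero in eq
  ... | suc _ = zero , subst (1 ≤_) (sym eq) (s≤s z≤n)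
  ... | zero with sum-positive (f ∘ suc) 1≤
  ...   | i , 1≤fi = suc i , 1≤fi

  sum-two : ∀ {n} (f : Fin n → ℕ) → (∀ i → f i ≤ 1) → 2 ≤ sum f → ∃₂ λ i j → i ≢ j × 1 ≤ f i × 1 ≤ f j
  sum-two {suc n} f f≤1 2≤ with f zero in eq | f≤1 zero
  ... | zero | _ with sum-two (f ∘ suc) (f≤1 ∘ suc) 2≤
  ...   | i , j , i≢j , 1≤fi , 1≤fj = suc i , suc j , i≢j ∘ Fin.suc-injective , 1≤fi , 1≤fj
  sum-two {suc n} f f≤1 2≤ | suc zero | _ with sum-positive (f ∘ suc) (s≤s⁻¹ 2≤)
  ...   | j , 1≤fj = zero , suc j , (λ ()) , subst (1 ≤_) (sym eq) (s≤s z≤n) , 1≤fj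
  sum-two {suc n} f f≤1 2≤ | suc (suc _) | s≤s ()

  length-filter-tabulate : ∀ {A : Set} {P : Pred A 0ℓ} (P? : Decidable P) {n} (f : Fin n → A) →
    length (filter P? (tabulate f)) ≡ sum (λ i → 𝟙 (P? (f i)))
  length-filter-tabulate P? {zero}  f = refl
  length-filter-tabulate P? {suc n} f with P? (f zero)
  ... | yes _ = cong suc (length-filter-tabulate P? (f ∘ suc))
  ... | no _  = length-filter-tabulate P? (f ∘ suc)

  length-filter-cartesianProduct : ∀ {A B : Set} {P : Pred (A × B) 0ℓ} (P? : Decidable P) {m n} (f : Fin m → A) (g : Fin n → B) →
    length (filter P? (cartesianProduct (tabulate f) (tabulate g))) ≡ sum (λ i → sum (λ j → 𝟙 (P? (f i , g j))))
  length-filter-cartesianProduct P? {zero}  f g = refl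
  length-filter-cartesianProduct P? {suc m} f g = begin
    length (filter P? (map (f zero ,_) (tabulate g) ++ rest))
      ≡⟨ cong length (List.filter-++ P? (map (f zero ,_) (tabulate g)) rest) ⟩
    length (filter P? (map (f zero ,_) (tabulate g)) ++ filter P? rest)
      ≡⟨ List.length-++ (filter P? (map (f zero ,_) (tabulate g))) ⟩
    length (filter P? (map (f zero ,_) (tabulate g))) + length (filter P? rest)
      ≡⟨ cong₂ _+_ (trans (cong (length ∘ filter P?) (List.map-tabulate g (f zero ,_))) (length-filter-tabulate P? (λ j → f zero , g j)))
                   (length-filter-cartesianProduct P? (f ∘ suc) g) ⟩
    sum (λ j → 𝟙 (P? (f zero , g j))) + sum (λ i → sum (λ j → 𝟙 (P? (f (suc i) , g j)))) ∎
    where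
    open ≡-Reasoning
    rest = cartesianProduct (tabulate (f ∘ suc)) (tabulate g)

  module Adjacency {n : ℕ} (G : Graph n) where
    open Graph G public

    e : Fin n → Fin n → ℕ
    e u v = 𝟙 (u ∼? v)

    deg : Fin n → ℕ
    deg u = sum (e u)

    degree≡deg : ∀ u → degree G u ≡ deg u
    degree≡deg u = length-filter-tabulate (u ∼?_) id

    e-symm : ∀ u v → e u v ≡ e v u
    e-symm u v = 𝟙-cong (u ∼? v) (v ∼? u) symm symm

    edge : ∀ {u v} → u ∼ v → e u v ≡ 1
    edge {u} {v} = 𝟙-yes (u ∼? v)

    1≤e⇒∼ : ∀ {u v} → 1 ≤ e u v → u ∼ v
    1≤e⇒∼ {u} {v} = 1≤𝟙⇒ (u ∼? v)

    e≤1 : ∀ u v → e u v ≤ 1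
    e≤1 u v = 𝟙≤1 (u ∼? v)

    handshake : sum deg ≡ 2 * size G
    handshake = begin
      sum deg                                                       ≡⟨ sum-cong-≗ (λ u → trans (sum-cong-≗ (orient u)) (∑-distrib-+ (up u) _)) ⟩
      sum (λ u → sum (up u) + sum (λ v → up v u))                   ≡⟨ ∑-distrib-+ (λ u → sum (up u)) _ ⟩
      sum (λ u → sum (up u)) + sum (λ u → sum (λ v → up v u))       ≡⟨ cong (sum (λ u → sum (up u)) +_) (∑-comm up) ⟨
      sum (λ u → sum (up u)) + sum (λ u → sum (up u))               ≡⟨ cong₂ _+_ size≡ (trans (+-identityʳ (size G)) size≡) ⟨
      2 * size G                                                    ∎
      where
      open ≡-Reasoning
      up : Fin n → Fin n → ℕ
      up u v = 𝟙 ((u <? v) ×-dec (u ∼? v))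

      size≡ : size G ≡ sum (λ u → sum (up u))
      size≡ = length-filter-cartesianProduct (λ (u , v) → (u <? v) ×-dec (u ∼? v)) id id

      up≡e : ∀ {u v} → u Fin.< v → up u v ≡ e u v
      up≡e {u} {v} u<v = 𝟙-cong ((u <? v) ×-dec (u ∼? v)) (u ∼? v) proj₂ (u<v ,_)

      up≡0 : ∀ {u v} → ¬ (u Fin.< v) → up u v ≡ 0
      up≡0 {u} {v} u≮v = 𝟙-no ((u <? v) ×-dec (u ∼? v)) (u≮v ∘ proj₁)

      orient : ∀ u v → e u v ≡ up u v + up v u
      orient u v with Fin.<-cmp u v
      ... | tri< u<v _ v≮u    = sym (trans (cong₂ _+_ (up≡e u<v) (up≡0 v≮u)) (+-identityʳ _))
      ... | tri> u≮v _ v<u    = sym (trans (cong₂ _+_ (up≡0 u≮v) (up≡e v<u)) (e-symm v u))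
      ... | tri≈ u≮u refl _   = trans (𝟙-no (u ∼? u) (irrefl refl)) (sym (cong₂ _+_ (up≡0 {u} u≮u) (up≡0 {u} u≮u)))

-- Edge counts around a vertex.

module GraphNeighbourhoods where
  open GraphCounting
  open import Data.Fin using (Fin; _≟_)
  open import Data.Nat using (ℕ; _+_; _*_; _≤_)
  open import Data.Nat.Properties hiding (_≟_; _<?_)
  open import Data.Nat.Tactic.RingSolver using (solve-∀)
  open import Data.Product using (∃₂; _×_; _,_)
  open import Relation.Binary.PropositionalEquality
  open import Relation.Nullary using (¬_; Dec; yes; no; contradiction)
  open import Relation.Nullary.Decidable using (_×-dec_; ¬?)

  module Neighbourhood {n : ℕ} (G : Graph n) (u : Fin n) where
    open Adjacency G

    Outside : Fin n → Set
    Outside v = v ≢ u × ¬ (u ∼ v)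

    outside? : ∀ v → Dec (Outside v)
    outside? v = ¬? (v ≟ u) ×-dec ¬? (u ∼? v)

    o : Fin n → ℕ
    o v = 𝟙 (outside? v)

    codeg : Fin n → ℕ
    codeg v = sum (λ x → e u x * e v x)

    -- Here `τ` is twice the number of edges inside the neighbourhood of `u`, and `E` is the number
    -- of edges between that neighbourhood and the outside.
    σ τ E D : ℕ
    σ = sum (λ v → e u v * deg v)
    τ = sum (λ v → e u v * codeg v)
    E = sum (λ v → o v * codeg v)
    D = sum (λ v → o v * deg v)

    r : Fin n → ℕ
    r v = sum (λ x → o x * e v x)

    partition : ∀ v → 𝟙 (v ≟ u) + (e u v + o v) ≡ 1
    partition v with v ≟ u | u ∼? v
    ... | yes refl | yes u∼u = contradiction u∼u (irrefl refl)
    ... | yes refl | no _    = refl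
    ... | no _     | yes _   = refl
    ... | no _     | no _    = refl

    sum-partition : ∀ (f : Fin n → ℕ) → sum f ≡ f u + (sum (λ v → e u v * f v) + sum (λ v → o v * f v))
    sum-partition f = begin
      sum f                                                            ≡⟨ sum-cong-≗ (λ v → trans (sym (*-identityˡ (f v))) (cong (_* f v) (sym (partition v)))) ⟩
      sum (λ v → (𝟙 (v ≟ u) + (e u v + o v)) * f v)                    ≡⟨ sum-cong-≗ (λ v → distribute (𝟙 (v ≟ u)) (e u v) (o v) (f v)) ⟩
      sum (λ v → 𝟙 (v ≟ u) * f v + (e u v * f v + o v * f v))          ≡⟨ ∑-distrib-+ {n} (λ v → 𝟙 (v ≟ u) * f v) _ ⟩
      sum (λ v → 𝟙 (v ≟ u) * f v) + sum (λ v → e u v * f v + o v * f v) ≡⟨ cong₂ _+_ (sum-single f u) (∑-distrib-+ {n} (λ v → e u v * f v) _) ⟩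
      f u + (sum (λ v → e u v * f v) + sum (λ v → o v * f v))          ∎
      where
      open ≡-Reasoning
      distribute : ∀ a b c d → (a + (b + c)) * d ≡ a * d + (b * d + c * d)
      distribute = solve-∀

    deg-split : ∀ v → deg v ≡ e v u + (codeg v + r v)
    deg-split v = sum-partition (e v)

    sum-deg : sum deg ≡ deg u + (σ + D)
    sum-deg = sum-partition deg

    -- The edges leaving the neighbourhood of `u` for the outside are counted from their two ends.
    sum-e-r : sum (λ v → e u v * r v) ≡ E
    sum-e-r = begin
      sum (λ v → e u v * r v)                          ≡⟨ sum-cong-≗ (λ v → *-distribˡ-sum {n} (e u v) _) ⟩
      sum (λ v → sum (λ x → e u v * (o x * e v x)))    ≡⟨ ∑-comm (λ v x → e u v * (o x * e v x)) ⟩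
      sum (λ x → sum (λ v → e u v * (o x * e v x)))    ≡⟨ sum-cong-≗ (λ x → trans (sum-cong-≗ (λ v → swap x v)) (sym (*-distribˡ-sum {n} (o x) _))) ⟩
      E                                                ∎
      where
      open ≡-Reasoning
      rearrange : ∀ a b c → a * (b * c) ≡ b * (a * c)
      rearrange = solve-∀
      swap : ∀ x v → e u v * (o x * e v x) ≡ o x * (e u v * e x v)
      swap x v = trans (rearrange (e u v) (o x) (e v x)) (cong (λ t → o x * (e u v * t)) (e-symm v x))

    -- The degree of a neighbour of `u` is made up of `u` itself, the common neighbours with `u` and
    -- the outside vertices.
    σ-split : σ ≡ deg u + (τ + E)
    σ-split = begin
      σ                                                                ≡⟨ sum-cong-≗ term ⟩
      sum (λ v → e u v + (e u v * codeg v + e u v * r v))              ≡⟨ ∑-distrib-+ (e u) _ ⟩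
      deg u + sum (λ v → e u v * codeg v + e u v * r v)                ≡⟨ cong (deg u +_) (trans (∑-distrib-+ {n} (λ v → e u v * codeg v) _) (cong (τ +_) sum-e-r)) ⟩
      deg u + (τ + E)                                                  ∎
      where
      open ≡-Reasoning
      expand : ∀ a c r → a * (a + (c + r)) ≡ a * a + (a * c + a * r)
      expand = solve-∀
      idem : ∀ v → e u v * e u v ≡ e u v
      idem v with u ∼? v
      ... | yes _ = refl
      ... | no _  = refl
      term : ∀ v → e u v * deg v ≡ e u v + (e u v * codeg v + e u v * r v)
      term v = begin
        e u v * deg v                                   ≡⟨ cong (e u v *_) (deg-split v) ⟩
        e u v * (e v u + (codeg v + r v))               ≡⟨ cong (λ t → e u v * (t + (codeg v + r v))) (e-symm v u) ⟩
        e u v * (e u v + (codeg v + r v))               ≡⟨ expand (e u v) (codeg v) (r v) ⟩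
        e u v * e u v + (e u v * codeg v + e u v * r v) ≡⟨ cong (_+ (e u v * codeg v + e u v * r v)) (idem v) ⟩
        e u v + (e u v * codeg v + e u v * r v)         ∎

    E≤D : E ≤ D
    E≤D = sum-mono (λ v → *-monoʳ-≤ (o v) (≤-trans (m≤m+n (codeg v) (r v)) (≤-trans (m≤n+m _ (e v u)) (≤-reflexive (sym (deg-split v))))))

    common-neighbours : ∀ v → 2 ≤ codeg v → ∃₂ λ a b → a ≢ b × (u ∼ a × v ∼ a) × (u ∼ b × v ∼ b)
    common-neighbours v 2≤ with sum-two (λ x → e u x * e v x) (λ x → *-mono-≤ (e≤1 u x) (e≤1 v x)) 2≤
    ... | a , b , a≢b , 1≤a , 1≤b = a , b , a≢b , both a 1≤a , both b 1≤b
      where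
      both : ∀ x → 1 ≤ e u x * e v x → u ∼ x × v ∼ x
      both x 1≤ with u ∼? x | v ∼? x
      ... | yes u∼x | yes v∼x = u∼x , v∼x
      both x () | yes _ | no _
      both x () | no _  | _

    two-neighbours : ∀ v → 2 ≤ deg v → ∃₂ λ a b → a ≢ b × v ∼ a × v ∼ b
    two-neighbours v 2≤ with sum-two (e v) (e≤1 v) 2≤
    ... | a , b , a≢b , 1≤a , 1≤b = a , b , a≢b , 1≤e⇒∼ 1≤a , 1≤e⇒∼ 1≤b

-- Forbidden theta graphs and the degree inequalities they force.

module ExtremalDegrees where
  open GraphCounting
  open GraphNeighbourhoods
  open import Data.Empty using (⊥)
  open import Data.Fin using (Fin; zero; suc; _≟_; toℕ)
  open import Data.Fin.Patterns using (0F; 1F; 2F; 3F; 4F)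
  open import Data.List using (List; _∷_; []; lookup; length)
  open import Data.List.Relation.Unary.All as All using (All; []; _∷_)
  open import Data.List.Relation.Unary.AllPairs using ([]; _∷_)
  open import Data.List.Relation.Unary.Unique.Propositional using (Unique)
  open import Data.List.Membership.Propositional.Properties using (∈-lookup)
  open import Data.Nat using (ℕ; zero; suc; _+_; _*_; _∸_; _≤_; _<_; s≤s; s≤s⁻¹)
  open import Data.Nat.Properties hiding (_≟_; _<?_)
  open import Data.Nat.Tactic.RingSolver using (solve-∀)
  open import Data.Product using (∃; _×_; _,_; proj₁; proj₂)
  open import Data.Sum using (_⊎_; inj₁; inj₂; [_,_]′)
  open import Function using (_∘_; id)
  open import Function.Definitions using (Injective)
  open import Relation.Binary.PropositionalEquality
  open import Relation.Nullary using (¬_; yes; no; contradiction)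

  lookup-injective : ∀ {A : Set} {xs : List A} → Unique xs → Injective _≡_ _≡_ (lookup xs)
  lookup-injective (_ ∷ _)         {zero}  {zero}  _  = refl
  lookup-injective (x∉xs ∷ _)      {zero}  {suc j} eq = contradiction eq (All.lookup x∉xs (∈-lookup j))
  lookup-injective (x∉xs ∷ _)      {suc i} {zero}  eq = contradiction (sym eq) (All.lookup x∉xs (∈-lookup i))
  lookup-injective (_ ∷ unique)    {suc i} {suc j} eq = cong suc (lookup-injective unique eq)

  module ForbiddenSubgraphs {n : ℕ} (G : Graph n) where
    open Graph G

    -- One orientation of each edge suffices; the reverse pairs added by `fromRelation` follow by
    -- symmetry. Taking `f` on all of `ℕ` lets the edge list evaluate to concrete pairs.
    θ-embedding : ∀ ls (f : ℕ → Fin n) → All (λ (i , j) → f i ∼ f j) (thetaEdges 2 ls) →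
      Injective _≡_ _≡_ (λ i → f (toℕ i)) → θ ls ⊑ G
    θ-embedding ls f edges injective = (λ i → f (toℕ i)) , injective ,
      λ i j (_ , ij) → [ All.lookup edges , symm ∘ All.lookup edges ]′ ij

    lookup-unique : ∀ {xs : List (Fin n)} (f : Fin (length xs) → Fin n) → Unique xs →
      (∀ i → f i ≡ lookup xs i) → Injective _≡_ _≡_ f
    lookup-unique f unique f≡ {i} {j} fi≡fj = lookup-injective unique (trans (sym (f≡ i)) (trans fi≡fj (f≡ j)))

    ∼⇒≢ : ∀ {p q} → p ∼ q → p ≢ q
    ∼⇒≢ p∼q refl = irrefl refl p∼q

    diamond : ∀ {p q x y} → p ∼ q → p ∼ x → q ∼ x → p ∼ y → q ∼ y → x ≢ y → θ (1 ∷ 2 ∷ 2 ∷ []) ⊑ G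
    diamond {p} {q} {x} {y} p∼q p∼x q∼x p∼y q∼y x≢y = θ-embedding (1 ∷ 2 ∷ 2 ∷ []) f
      (p∼q ∷ p∼x ∷ symm q∼x ∷ p∼y ∷ symm q∼y ∷ [])
      (lookup-unique {p ∷ q ∷ x ∷ y ∷ []} _
        ((∼⇒≢ p∼q ∷ ∼⇒≢ p∼x ∷ ∼⇒≢ p∼y ∷ []) ∷ (∼⇒≢ q∼x ∷ ∼⇒≢ q∼y ∷ []) ∷ (x≢y ∷ []) ∷ [] ∷ [])
        λ { 0F → refl ; 1F → refl ; 2F → refl ; 3F → refl })
      where
      f : ℕ → Fin n
      f 0 = p
      f 1 = q
      f 2 = x
      f _ = y

    -- The triangle `p q x` and the 4-cycle `p s t q` share the edge `pq`; the distinctness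
    -- assumptions are those that adjacency does not supply.
    house : ∀ {p q x s t} → p ∼ q → p ∼ x → q ∼ x → p ∼ s → s ∼ t → t ∼ q →
      x ≢ s → x ≢ t → p ≢ t → q ≢ s → θ (1 ∷ 2 ∷ 3 ∷ []) ⊑ G
    house {p} {q} {x} {s} {t} p∼q p∼x q∼x p∼s s∼t t∼q x≢s x≢t p≢t q≢s = θ-embedding (1 ∷ 2 ∷ 3 ∷ []) f
      (p∼q ∷ p∼x ∷ symm q∼x ∷ p∼s ∷ s∼t ∷ t∼q ∷ [])
      (lookup-unique {p ∷ q ∷ x ∷ s ∷ t ∷ []} _
        ((∼⇒≢ p∼q ∷ ∼⇒≢ p∼x ∷ ∼⇒≢ p∼s ∷ p≢t ∷ []) ∷ (∼⇒≢ q∼x ∷ q≢s ∷ ∼⇒≢ (symm t∼q) ∷ [])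
          ∷ (x≢s ∷ x≢t ∷ []) ∷ (∼⇒≢ s∼t ∷ []) ∷ [] ∷ [])
        λ { 0F → refl ; 1F → refl ; 2F → refl ; 3F → refl ; 4F → refl })
      where
      f : ℕ → Fin n
      f 0 = p
      f 1 = q
      f 2 = x
      f 3 = s
      f _ = t

  -- Expresses `Q - P = (B - A) + slack` without truncated subtraction, so that the equation is one
  -- between natural numbers.
  ≤-by-difference : ∀ {P Q A B} slack → A ≤ B → Q + A ≡ P + B + slack → P ≤ Q
  ≤-by-difference {P} {Q} {A} {B} slack A≤B Q+A≡ = +-cancelʳ-≤ A P Q (begin
    P + A           ≤⟨ +-monoʳ-≤ P A≤B ⟩
    P + B           ≤⟨ m≤m+n (P + B) slack ⟩
    P + B + slack   ≡⟨ Q+A≡ ⟨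
    Q + A           ∎)
    where open ≤-Reasoning

  -- Recognises G as the graph H: the 4-cycle is u a w b, and the neighbours of u other
  -- than a and b are paired up by the triangles.
  record TrianglesAndCycle {n : ℕ} (G : Graph n) : Set where
    open Graph G
    field
      u w a b        : Fin n
      w≢u            : w ≢ u
      u≁w            : ¬ (u ∼ w)
      a≢b            : a ≢ b
      u∼a            : u ∼ a
      w∼a            : w ∼ a
      u∼b            : u ∼ b
      w∼b            : w ∼ b
      cover          : ∀ v → v ≡ u ⊎ v ≡ w ⊎ u ∼ v
      neighbour-of-w : ∀ {x} → w ∼ x → x ≡ a ⊎ x ≡ b
      isolated-a     : ∀ {v} → u ∼ v → ¬ (v ∼ a)
      isolated-b     : ∀ {v} → u ∼ v → ¬ (v ∼ b)
      partner        : ∀ {v} → u ∼ v → v ≢ a → v ≢ b → ∃ λ x → u ∼ x × v ∼ x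
      partner-unique : ∀ {v x y} → u ∼ v → u ∼ x → v ∼ x → u ∼ y → v ∼ y → x ≡ y

  -- Twice the difference of the two sides is at least
  -- 2y (d - 2) (y - 1 - d) + (y + 2) (d - 2) + y² - 7y + 4.
  below-critical : ∀ {y d σ} → 7 ≤ y → 2 ≤ d → d < y → 2 * σ ≤ 3 * y + 5 + d →
    y * (d * d + σ) ≤ (1 + y) * (1 + y) * d
  below-critical {σ = σ} 7≤y 2≤d d<y 2σ≤ with m≤n⇒∃[o]m+o≡n 2≤d
  ... | a , refl with m≤n⇒∃[o]m+o≡n d<y
  ...   | b , refl = *-cancelˡ-≤ 2 (begin
    2 * (y * (d * d + σ))                       ≡⟨ rearrange y d σ ⟩
    2 * y * (d * d) + y * (2 * σ)               ≤⟨ +-monoʳ-≤ (2 * y * (d * d)) (*-monoʳ-≤ y 2σ≤) ⟩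
    -- With `a = d - 2` and `b = y - 1 - d` every term of the slack is nonnegative; the remaining
    -- `y² - 7y` is the difference in `y * 7 ≤ y * y`.
    2 * y * (d * d) + y * (3 * y + 5 + d)       ≤⟨ ≤-by-difference (2 * y * a * b + (y + 2) * a + 4) (*-monoʳ-≤ y 7≤y) (identity a b) ⟩
    2 * ((1 + y) * (1 + y) * d)                 ∎)
    where
    open ≤-Reasoning
    d = 2 + a
    y = 1 + d + b
    rearrange : ∀ y d σ → 2 * (y * (d * d + σ)) ≡ 2 * y * (d * d) + y * (2 * σ)
    rearrange = solve-∀
    identity : ∀ a b → 2 * ((1 + (1 + (2 + a) + b)) * (1 + (1 + (2 + a) + b)) * (2 + a)) + (1 + (2 + a) + b) * 7 ≡
      2 * (1 + (2 + a) + b) * ((2 + a) * (2 + a)) + (1 + (2 + a) + b) * (3 * (1 + (2 + a) + b) + 5 + (2 + a))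
      + (1 + (2 + a) + b) * (1 + (2 + a) + b) + (2 * (1 + (2 + a) + b) * a * b + ((1 + (2 + a) + b) + 2) * a + 4)
    identity = solve-∀

  module DegreeBound {n : ℕ} (G : Graph n) (κ : ℕ) (3≤κ : 3 ≤ κ)
      (sum-deg≡ : sum (Adjacency.deg G) ≡ 2 * (3 * κ + 4))
      (2≤deg : ∀ v → 2 ≤ Adjacency.deg G v)
      (no-diamond : ¬ (θ (1 ∷ 2 ∷ 2 ∷ []) ⊑ G)) (no-house : ¬ (θ (1 ∷ 2 ∷ 3 ∷ []) ⊑ G))
      (u : Fin n) where
    open Neighbourhood G u
    open Adjacency G
    open ForbiddenSubgraphs G

    Y d : ℕ
    Y = 1 + 2 * κ
    d = deg u

    -- Two triangles on one edge form the forbidden `θ (1 ∷ 2 ∷ 2 ∷ [])`.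
    common-neighbour-unique : ∀ {p q x y} → p ∼ q → p ∼ x → q ∼ x → p ∼ y → q ∼ y → x ≡ y
    common-neighbour-unique {x = x} {y} p∼q p∼x q∼x p∼y q∼y with x ≟ y
    ... | yes x≡y = x≡y
    ... | no x≢y  = contradiction (diamond p∼q p∼x q∼x p∼y q∼y x≢y) no-diamond

    -- A triangle `u a v` and the 4-cycle `u a w b` form a house along `ua`, unless `v` is `b`; in
    -- that case the edge `ab` lies in triangles with both `u` and `w`.
    two-paths⇒no-triangle : ∀ {w a b v} → w ≢ u → a ≢ b → u ∼ a → w ∼ a → u ∼ b → w ∼ b →
      u ∼ v → v ∼ a → v ≢ w → ⊥
    two-paths⇒no-triangle {w} {a} {b} {v} w≢u a≢b u∼a w∼a u∼b w∼b u∼v v∼a v≢w with v ≟ b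
    ... | yes refl = w≢u (sym (common-neighbour-unique v∼a (symm u∼b) (symm u∼a) (symm w∼b) (symm w∼a)))
    ... | no v≢b   = no-house (house u∼a u∼v (symm v∼a) u∼b (symm w∼b) w∼a v≢b v≢w (w≢u ∘ sym) a≢b)

    codeg≤1 : ∀ v → u ∼ v → codeg v ≤ 1
    codeg≤1 v u∼v with codeg v ≤? 1
    ... | yes c≤1 = c≤1
    ... | no c≰1 with common-neighbours v (≰⇒> c≰1)
    ...   | a , b , a≢b , (u∼a , v∼a) , (u∼b , v∼b) = contradiction (common-neighbour-unique u∼v u∼a v∼a u∼b v∼b) a≢b

    e*codeg≤e : ∀ v → e u v * codeg v ≤ e u v
    e*codeg≤e v = ≤-trans (𝟙-*-mono (u ∼? v) (codeg≤1 v)) (≤-reflexive (*-identityʳ (e u v)))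

    τ≤d : τ ≤ d
    τ≤d = sum-mono e*codeg≤e

    -- Each neighbour of `u` has a neighbour other than `u`, which is either adjacent to `u` or
    -- outside.
    d≤τ+E : d ≤ τ + E
    d≤τ+E = begin
      d                                                  ≤⟨ sum-mono reaches ⟩
      sum (λ v → e u v * codeg v + e u v * r v)          ≡⟨ ∑-distrib-+ {n} (λ v → e u v * codeg v) _ ⟩
      τ + sum (λ v → e u v * r v)                        ≡⟨ cong (τ +_) sum-e-r ⟩
      τ + E                                              ∎
      where
      open ≤-Reasoning
      reaches : ∀ v → e u v ≤ e u v * codeg v + e u v * r v
      reaches v = begin
        e u v                              ≡⟨ *-identityʳ (e u v) ⟨
        e u v * 1                          ≤⟨ 𝟙-*-mono (u ∼? v) (λ u∼v → s≤s⁻¹ (≤-trans (2≤deg v)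
                                                (≤-reflexive (trans (deg-split v) (cong (_+ (codeg v + r v)) (edge (symm u∼v))))))) ⟩
        e u v * (codeg v + r v)            ≡⟨ *-distribˡ-+ (e u v) (codeg v) (r v) ⟩
        e u v * codeg v + e u v * r v      ∎

    two-paths⇒codeg≡0 : ∀ {w a b} → Outside w → a ≢ b → u ∼ a → w ∼ a → u ∼ b → w ∼ b → codeg a ≡ 0
    two-paths⇒codeg≡0 {w} {a} (w≢u , u≁w) a≢b u∼a w∼a u∼b w∼b = sum-zero vanish
      where
      vanish : ∀ x → e u x * e a x ≡ 0
      vanish x with u ∼? x | a ∼? x
      ... | no _    | _       = refl
      ... | yes _   | no _    = refl
      ... | yes u∼x | yes a∼x = contradiction
        (two-paths⇒no-triangle w≢u a≢b u∼a w∼a u∼b w∼b u∼x (symm a∼x) λ { refl → u≁w u∼x }) id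

    -- As `codeg` is at most 1 on neighbours of `u`, the number `d - τ` counts those in no triangle
    -- with `u`. Two common neighbours of `u` and `w` lie on a 4-cycle and would both be counted.
    codeg-outside≤1 : d ≤ τ + 1 → ∀ w → Outside w → codeg w ≤ 1
    codeg-outside≤1 d≤τ+1 w outside with codeg w ≤? 1
    ... | yes c≤1 = c≤1
    ... | no c≰1 with common-neighbours w (≰⇒> c≰1)
    ...   | a , b , a≢b , (u∼a , w∼a) , (u∼b , w∼b) = contradiction (begin
        2 + τ                                    ≤⟨ +-monoˡ-≤ τ (≤-trans (≤-reflexive (sym twice))
                                                      (sum-unique-≤ gap ((a≢b ∷ []) ∷ [] ∷ []))) ⟩
        sum gap + τ                              ≡⟨ +-comm (sum gap) τ ⟩
        τ + sum gap                              ≡⟨ ∑-distrib-+ {n} (λ v → e u v * codeg v) gap ⟨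
        sum (λ v → e u v * codeg v + gap v)      ≡⟨ sum-cong-≗ (λ v → m+[n∸m]≡n (e*codeg≤e v)) ⟩
        d                                        ≤⟨ d≤τ+1 ⟩
        τ + 1                                    ≡⟨ +-comm τ 1 ⟩
        1 + τ                                    ∎) (<-irrefl refl)
      where
      open ≤-Reasoning
      gap : Fin n → ℕ
      gap v = e u v ∸ e u v * codeg v
      gap≡1 : ∀ {v} → u ∼ v → codeg v ≡ 0 → gap v ≡ 1
      gap≡1 {v} u∼v c≡0 rewrite c≡0 | edge u∼v = refl
      twice : gap a + (gap b + 0) ≡ 2
      twice = cong₂ (λ x y → x + (y + 0))
        (gap≡1 u∼a (two-paths⇒codeg≡0 outside a≢b u∼a w∼a u∼b w∼b))
        (gap≡1 u∼b (two-paths⇒codeg≡0 outside (a≢b ∘ sym) u∼b w∼b u∼a w∼a))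

    -- An outside vertex has degree at least 2 but sends at most one edge to the neighbourhood of
    -- `u`.
    2E≤D : d ≤ τ + 1 → 2 * E ≤ D
    2E≤D d≤τ+1 = begin
      2 * E                                ≡⟨ *-distribˡ-sum {n} 2 _ ⟩
      sum (λ v → 2 * (o v * codeg v))      ≡⟨ sum-cong-≗ (λ v → rearrange (o v) (codeg v)) ⟩
      sum (λ v → o v * (2 * codeg v))      ≤⟨ sum-mono (λ v → 𝟙-*-mono (outside? v) (λ outside →
                                                ≤-trans (*-monoʳ-≤ 2 (codeg-outside≤1 d≤τ+1 v outside)) (2≤deg v))) ⟩
      D                                    ∎
      where
      open ≤-Reasoning
      rearrange : ∀ o c → 2 * (o * c) ≡ o * (2 * c)
      rearrange = solve-∀

    -- The constant is `2m` in terms of `Y`.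
    degree-sum : d + (σ + D) ≡ 3 * Y + 5
    degree-sum = trans (sym sum-deg) (trans sum-deg≡ (arithmetic κ))
      where
      arithmetic : ∀ κ → 2 * (3 * κ + 4) ≡ 3 * (1 + 2 * κ) + 5
      arithmetic = solve-∀

    -- In the sum of `degree-sum` and `σ-split` the degree `d` cancels, and `E - D` is dropped.
    2σ≤ : 2 * σ ≤ 3 * Y + 5 + τ
    2σ≤ = ≤-by-difference 0 E≤D (begin
      3 * Y + 5 + τ + E         ≡⟨ cong (λ t → t + τ + E) degree-sum ⟨
      d + (σ + D) + τ + E       ≡⟨ rearrange d σ D τ E ⟩
      σ + (d + (τ + E)) + D + 0 ≡⟨ cong (λ t → σ + t + D + 0) σ-split ⟨
      σ + σ + D + 0             ≡⟨ cong (λ t → t + D + 0) (cong (σ +_) (+-identityʳ σ)) ⟨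
      2 * σ + D + 0             ∎)
      where
      open ≡-Reasoning
      rearrange : ∀ d σ D τ E → d + (σ + D) + τ + E ≡ σ + (d + (τ + E)) + D + 0
      rearrange = solve-∀

    3σ≤ : d ≤ τ + 1 → 3 * σ ≤ 3 * Y + 5 + d + 2 * τ
    3σ≤ d≤τ+1 = ≤-by-difference 0 (2E≤D d≤τ+1) (begin
      3 * Y + 5 + d + 2 * τ + 2 * E         ≡⟨ cong (λ t → t + d + 2 * τ + 2 * E) degree-sum ⟨
      d + (σ + D) + d + 2 * τ + 2 * E       ≡⟨ rearrange d σ D τ E ⟩
      σ + 2 * (d + (τ + E)) + D + 0         ≡⟨ cong (λ t → σ + 2 * t + D + 0) σ-split ⟨
      3 * σ + D + 0                         ∎)
      where
      open ≡-Reasoning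
      rearrange : ∀ d σ D τ E → d + (σ + D) + d + 2 * τ + 2 * E ≡ σ + 2 * (d + (τ + E)) + D + 0
      rearrange = solve-∀

    3d+D≤ : 3 * d + D ≤ 3 * Y + 5
    3d+D≤ = begin
      3 * d + D                   ≡⟨ rearrange d D ⟩
      d + (d + d + D)             ≤⟨ +-monoʳ-≤ d (+-monoˡ-≤ D (+-monoʳ-≤ d d≤τ+E)) ⟩
      d + (d + (τ + E) + D)       ≡⟨ cong (λ t → d + (t + D)) σ-split ⟨
      d + (σ + D)                 ≡⟨ degree-sum ⟩
      3 * Y + 5                   ∎
      where
      open ≤-Reasoning
      rearrange : ∀ d D → 3 * d + D ≡ d + (d + d + D)
      rearrange = solve-∀

    -- Here `k ≥ 4` enters: `Y` is `2k - 1`, and `below-critical` asks for at least 7.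
    7≤Y : 7 ≤ Y
    7≤Y = s≤s (*-monoʳ-≤ 2 3≤κ)

    small-degree : d < Y → Y * (d * d + σ) ≤ (1 + Y) * (1 + Y) * d
    small-degree d<Y = below-critical 7≤Y (2≤deg u) d<Y (≤-trans 2σ≤ (+-monoʳ-≤ (3 * Y + 5) τ≤d))

    critical-degree : d ≡ Y → Y * (d * d + σ) ≤ (1 + Y) * (1 + Y) * d
    critical-degree d≡Y = begin
      Y * (d * d + σ)              ≡⟨ cong (λ d → Y * (d * d + σ)) d≡Y ⟩
      Y * (Y * Y + σ)              ≤⟨ *-monoʳ-≤ Y (+-monoʳ-≤ (Y * Y) σ≤) ⟩
      Y * (Y * Y + (2 * Y + 1))    ≡⟨ square Y ⟩
      (1 + Y) * (1 + Y) * Y        ≡⟨ cong ((1 + Y) * (1 + Y) *_) d≡Y ⟨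
      (1 + Y) * (1 + Y) * d        ∎
      where
      open ≤-Reasoning
      square : ∀ Y → Y * (Y * Y + (2 * Y + 1)) ≡ (1 + Y) * (1 + Y) * Y
      square = solve-∀
      -- The first case gives `3σ ≤ 6Y + 5`. In the second, `τ ≤ d - 2` gives `2σ ≤ 4Y + 3`.
      σ< : σ < 2 * Y + 2
      σ< with d ≤? τ + 1
      ... | yes d≤τ+1 = *-cancelˡ-< 3 σ (2 * Y + 2) (begin-strict
        3 * σ                         ≤⟨ 3σ≤ d≤τ+1 ⟩
        3 * Y + 5 + d + 2 * τ         ≤⟨ +-monoʳ-≤ (3 * Y + 5 + d) (*-monoʳ-≤ 2 τ≤d) ⟩
        3 * Y + 5 + d + 2 * d         ≡⟨ cong (λ d → 3 * Y + 5 + d + 2 * d) d≡Y ⟩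
        3 * Y + 5 + Y + 2 * Y         <⟨ n<1+n _ ⟩
        1 + (3 * Y + 5 + Y + 2 * Y)   ≡⟨ collect Y ⟩
        3 * (2 * Y + 2)               ∎)
        where
        collect : ∀ Y → 1 + (3 * Y + 5 + Y + 2 * Y) ≡ 3 * (2 * Y + 2)
        collect = solve-∀
      ... | no d≰τ+1 = *-cancelˡ-< 2 σ (2 * Y + 2) (begin-strict
        2 * σ                         ≤⟨ 2σ≤ ⟩
        3 * Y + 5 + τ                 <⟨ n<1+n _ ⟩
        1 + (3 * Y + 5 + τ)           ≡⟨ collect₁ Y τ ⟩
        3 * Y + 4 + (1 + (τ + 1))     ≤⟨ +-monoʳ-≤ (3 * Y + 4) (≰⇒> d≰τ+1) ⟩
        3 * Y + 4 + d                 ≡⟨ cong (3 * Y + 4 +_) d≡Y ⟩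
        3 * Y + 4 + Y                 ≡⟨ collect₂ Y ⟩
        2 * (2 * Y + 2)               ∎)
        where
        collect₁ : ∀ Y τ → 1 + (3 * Y + 5 + τ) ≡ 3 * Y + 4 + (1 + (τ + 1))
        collect₁ = solve-∀
        collect₂ : ∀ Y → 3 * Y + 4 + Y ≡ 2 * (2 * Y + 2)
        collect₂ = solve-∀
      σ≤ : σ ≤ 2 * Y + 1
      σ≤ = s≤s⁻¹ (≤-trans σ< (≤-reflexive (+-suc (2 * Y) 1)))

    action≡ : sum (λ v → e u v * (d + deg v)) ≡ d * d + σ
    action≡ = begin
      sum (λ v → e u v * (d + deg v))                        ≡⟨ sum-cong-≗ (λ v → distribute (e u v) d (deg v)) ⟩
      sum (λ v → d * e u v + e u v * deg v)                  ≡⟨ ∑-distrib-+ {n} (λ v → d * e u v) _ ⟩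
      sum (λ v → d * e u v) + σ                              ≡⟨ cong (_+ σ) (*-distribˡ-sum {n} d _) ⟨
      d * d + σ                                              ∎
      where
      open ≡-Reasoning
      distribute : ∀ e d c → e * (d + c) ≡ d * e + e * c
      distribute = solve-∀

    degree-bound : d ≤ Y → Y * sum (λ v → e u v * (d + deg v)) ≤ (1 + Y) * (1 + Y) * d
    degree-bound d≤Y rewrite action≡ with m≤n⇒m<n∨m≡n d≤Y
    ... | inj₁ d<Y = small-degree d<Y
    ... | inj₂ d≡Y = critical-degree d≡Y

    module LargeDegree (Y<d : Y < d) where

      arithmetic : ∀ Y → 3 * Y + 5 ≡ 3 * (1 + Y) + 2
      arithmetic = solve-∀

      D≤2 : D ≤ 2
      D≤2 = +-cancelˡ-≤ (3 * (1 + Y)) D 2 (begin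
        3 * (1 + Y) + D   ≤⟨ +-monoˡ-≤ D (*-monoʳ-≤ 3 Y<d) ⟩
        3 * d + D         ≤⟨ 3d+D≤ ⟩
        3 * Y + 5         ≡⟨ arithmetic Y ⟩
        3 * (1 + Y) + 2   ∎)
        where open ≤-Reasoning

      d≡1+Y : d ≡ 1 + Y
      d≡1+Y = ≤-antisym (s≤s⁻¹ (*-cancelˡ-< 3 d (2 + Y) (begin-strict
        3 * d             ≤⟨ m≤m+n (3 * d) D ⟩
        3 * d + D         ≤⟨ 3d+D≤ ⟩
        3 * Y + 5         <⟨ n<1+n _ ⟩
        1 + (3 * Y + 5)   ≡⟨ step Y ⟩
        3 * (2 + Y)       ∎))) Y<d
        where
        open ≤-Reasoning
        step : ∀ Y → 1 + (3 * Y + 5) ≡ 3 * (2 + Y)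
        step = solve-∀

      -- The degrees add up to `3d + 2`, whereas `τ ≤ d` and `E ≤ D` allow at most `3d + 2D`.
      1≤D : 1 ≤ D
      1≤D = *-cancelˡ-≤ 2 (+-cancelˡ-≤ (3 * (1 + Y)) (2 * 1) (2 * D) (begin
        3 * (1 + Y) + 2           ≡⟨ arithmetic Y ⟨
        3 * Y + 5                 ≡⟨ degree-sum ⟨
        d + (σ + D)               ≡⟨ cong (λ t → d + (t + D)) σ-split ⟩
        d + (d + (τ + E) + D)     ≤⟨ +-monoʳ-≤ d (+-monoˡ-≤ D (+-monoʳ-≤ d (+-mono-≤ τ≤d E≤D))) ⟩
        d + (d + (d + D) + D)     ≡⟨ collect d D ⟩
        3 * d + 2 * D             ≡⟨ cong (λ d → 3 * d + 2 * D) d≡1+Y ⟩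
        3 * (1 + Y) + 2 * D       ∎))
        where
        open ≤-Reasoning
        collect : ∀ d D → d + (d + (d + D) + D) ≡ 3 * d + 2 * D
        collect = solve-∀

      module OutsideVertex (w : Fin n) (w-outside : Outside w) where

        o*deg≡deg : ∀ {v} → Outside v → o v * deg v ≡ deg v
        o*deg≡deg {v} outside = trans (cong (_* deg v) (𝟙-yes (outside? v) outside)) (*-identityˡ (deg v))

        deg-w≤2 : deg w ≤ 2
        deg-w≤2 = begin
          deg w             ≡⟨ o*deg≡deg w-outside ⟨
          o w * deg w       ≡⟨ +-identityʳ _ ⟨
          o w * deg w + 0   ≤⟨ sum-unique-≤ (λ v → o v * deg v) {w ∷ []} ([] ∷ []) ⟩
          D                 ≤⟨ D≤2 ⟩
          2                 ∎
          where open ≤-Reasoning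

        -- Two outside vertices would contribute at least 4 to `D ≤ 2`.
        outside⇒≡w : ∀ v → Outside v → v ≡ w
        outside⇒≡w v outside with v ≟ w
        ... | yes v≡w = v≡w
        ... | no v≢w  = contradiction (begin
          2 + 2                             ≤⟨ +-mono-≤ (2≤deg v) (2≤deg w) ⟩
          deg v + deg w                     ≡⟨ cong₂ _+_ (o*deg≡deg outside) (trans (+-identityʳ _) (o*deg≡deg w-outside)) ⟨
          o v * deg v + (o w * deg w + 0)   ≤⟨ sum-unique-≤ (λ v → o v * deg v) ((v≢w ∷ []) ∷ [] ∷ []) ⟩
          D                                 ≤⟨ D≤2 ⟩
          2                                 ∎) λ { (s≤s (s≤s ())) }
          where open ≤-Reasoning

        cover : ∀ v → v ≡ u ⊎ v ≡ w ⊎ u ∼ v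
        cover v with v ≟ u | u ∼? v
        ... | yes v≡u | _       = inj₁ v≡u
        ... | no _    | yes u∼v = inj₂ (inj₂ u∼v)
        ... | no v≢u  | no u≁v  = inj₂ (inj₁ (outside⇒≡w v (v≢u , u≁v)))

        w∼⇒u∼ : ∀ {x} → w ∼ x → u ∼ x
        w∼⇒u∼ {x} w∼x with cover x
        ... | inj₁ refl        = contradiction (symm w∼x) (proj₂ w-outside)
        ... | inj₂ (inj₁ refl) = contradiction w∼x (irrefl refl)
        ... | inj₂ (inj₂ u∼x)  = u∼x

        order : n ≡ 2 * κ + 4
        order = begin
          n                                                          ≡⟨ sum-ones n ⟨
          sum {n} (λ _ → 1)                                          ≡⟨ sum-partition (λ _ → 1) ⟩
          1 + (sum (λ v → e u v * 1) + sum (λ v → o v * 1))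
            ≡⟨ cong₂ (λ x y → 1 + (x + y)) (sum-cong-≗ (λ v → *-identityʳ (e u v))) (trans (sum-cong-≗ only-w) (sum-single (λ _ → 1) w)) ⟩
          1 + (d + 1)                                                ≡⟨ cong (λ d → 1 + (d + 1)) d≡1+Y ⟩
          1 + (1 + Y + 1)                                            ≡⟨ collect κ ⟩
          2 * κ + 4                                                  ∎
          where
          open ≡-Reasoning
          only-w : ∀ v → o v * 1 ≡ 𝟙 (v ≟ w) * 1
          only-w v = cong (_* 1) (𝟙-cong (outside? v) (v ≟ w) (outside⇒≡w v) λ { refl → w-outside })
          collect : ∀ κ → 1 + (1 + (1 + 2 * κ) + 1) ≡ 2 * κ + 4
          collect = solve-∀

        structure : TrianglesAndCycle G
        structure with two-neighbours w (2≤deg w)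
        ... | a , b , a≢b , w∼a , w∼b = record
          { u = u ; w = w ; a = a ; b = b
          ; w≢u = proj₁ w-outside
          ; u≁w = proj₂ w-outside
          ; a≢b = a≢b
          ; u∼a = w∼⇒u∼ w∼a
          ; w∼a = w∼a
          ; u∼b = w∼⇒u∼ w∼b
          ; w∼b = w∼b
          ; cover = cover
          ; neighbour-of-w = neighbour-of-w
          ; isolated-a = λ u∼v v∼a → two-paths⇒no-triangle (proj₁ w-outside) a≢b (w∼⇒u∼ w∼a) w∼a (w∼⇒u∼ w∼b) w∼b u∼v v∼a (u∼⇒≢w u∼v)
          ; isolated-b = λ u∼v v∼b → two-paths⇒no-triangle (proj₁ w-outside) (a≢b ∘ sym) (w∼⇒u∼ w∼b) w∼b (w∼⇒u∼ w∼a) w∼a u∼v v∼b (u∼⇒≢w u∼v)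
          ; partner = partner
          ; partner-unique = λ u∼v u∼x v∼x u∼y v∼y → common-neighbour-unique u∼v u∼x v∼x u∼y v∼y
          }
          where
          u∼⇒≢w : ∀ {v} → u ∼ v → v ≢ w
          u∼⇒≢w u∼v refl = proj₂ w-outside u∼v

          neighbour-of-w : ∀ {x} → w ∼ x → x ≡ a ⊎ x ≡ b
          neighbour-of-w {x} w∼x with x ≟ a | x ≟ b
          ... | yes x≡a | _       = inj₁ x≡a
          ... | no _    | yes x≡b = inj₂ x≡b
          ... | no x≢a  | no x≢b  = contradiction (begin
            3                                 ≡⟨ cong₂ _+_ (edge w∼x) (cong₂ (λ p q → p + (q + 0)) (edge w∼a) (edge w∼b)) ⟨
            e w x + (e w a + (e w b + 0))     ≤⟨ sum-unique-≤ (e w) ((x≢a ∷ x≢b ∷ []) ∷ (a≢b ∷ []) ∷ [] ∷ []) ⟩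
            deg w                             ≤⟨ deg-w≤2 ⟩
            2                                 ∎) λ { (s≤s (s≤s ())) }
            where open ≤-Reasoning

          u-neighbour⇒partner : ∀ {v x} → v ≢ a → v ≢ b → v ∼ x → x ≢ u → u ∼ x
          u-neighbour⇒partner {v} {x} v≢a v≢b v∼x x≢u with cover x
          ... | inj₁ x≡u         = contradiction x≡u x≢u
          ... | inj₂ (inj₂ u∼x)  = u∼x
          ... | inj₂ (inj₁ refl) with neighbour-of-w (symm v∼x)
          ...   | inj₁ v≡a = contradiction v≡a v≢a
          ...   | inj₂ v≡b = contradiction v≡b v≢b

          partner : ∀ {v} → u ∼ v → v ≢ a → v ≢ b → ∃ λ x → u ∼ x × v ∼ x
          partner {v} u∼v v≢a v≢b with two-neighbours v (2≤deg v)
          ... | x , y , x≢y , v∼x , v∼y with x ≟ u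
          ...   | no x≢u   = x , u-neighbour⇒partner v≢a v≢b v∼x x≢u , v∼x
          ...   | yes refl = y , u-neighbour⇒partner v≢a v≢b v∼y (x≢y ∘ sym) , v∼y

      structure×order : TrianglesAndCycle G × n ≡ 2 * κ + 4
      structure×order = structure , order
        where
        ∃w = sum-positive (λ w → o w * deg w) 1≤D
        open OutsideVertex (proj₁ ∃w) (1≤𝟙-*⇒ (outside? (proj₁ ∃w)) {deg (proj₁ ∃w)} (proj₂ ∃w)) using (structure; order)

-- Reconstruction of the graph H from its local structure.

module Recognition where
  open GraphCounting
  open ExtremalDegrees
  open import Data.Fin as Fin using (Fin; zero; suc; _≟_; _<?_; splitAt; join; remQuot; combine)
  import Data.Fin.Properties as Fin
  open import Data.Fin.Patterns using (0F; 1F; 2F; 3F)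
  open import Data.Fin.Permutation using (↔⇒≡)
  open import Data.List using (List; lookup; length; filter; allFin)
  open import Data.List.Relation.Unary.All as All using (All)
  import Data.List.Relation.Unary.All.Properties as All
  import Data.List.Relation.Unary.Any as Any
  import Data.List.Relation.Unary.Any.Properties as Any
  open import Data.List.Membership.Propositional using (_∈_)
  open import Data.List.Membership.Propositional.Properties using (∈-lookup; ∈-filter⁺; ∈-allFin)
  open import Data.List.Relation.Unary.Unique.Propositional using (Unique)
  import Data.List.Relation.Unary.Unique.Propositional.Properties as Unique
  open import Data.Nat using (ℕ; suc; _*_; _+_)
  open import Data.Product using (∃; ∃₂; _×_; _,_; proj₁; proj₂)
  open import Data.Sum using (_⊎_; inj₁; inj₂; [_,_]′)
  open import Data.Unit using (tt)
  open import Function using (_∘_; id)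
  open import Function.Bundles using (_⇔_; mk⇔; mk↔ₛ′; Equivalence)
  open import Relation.Binary using (tri<; tri≈; tri>)
  open import Relation.Binary.PropositionalEquality
  open import Relation.Nullary using (¬_; Dec; yes; no; contradiction)
  open import Relation.Nullary.Decidable using (_×-dec_; toWitness; toWitnessFalse)

  -- The graph `Hgraph p 4` parametrised by its number of triangles, which keeps division out of the
  -- vertex type.
  triangles∙C₄ : (t : ℕ) → Graph (suc (t * 2) + 3)
  triangles∙C₄ t = identify (triangles t) zero (cycle 4) zero

  module Structure {n : ℕ} {G : Graph n} (S : TrianglesAndCycle G) where
    open Graph G
    open ForbiddenSubgraphs G using (∼⇒≢)
    open TrianglesAndCycle S public

    data Kind (v : Fin n) : Set where
      centre : v ≡ u → Kind v
      apex   : v ≡ w → Kind v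
      side-a : v ≡ a → Kind v
      side-b : v ≡ b → Kind v
      rim    : u ∼ v → v ≢ a → v ≢ b → Kind v

    classify : ∀ v → Kind v
    classify v with cover v | v ≟ a | v ≟ b
    ... | inj₁ v≡u        | _       | _       = centre v≡u
    ... | inj₂ (inj₁ v≡w) | _       | _       = apex v≡w
    ... | inj₂ (inj₂ _)   | yes v≡a | _       = side-a v≡a
    ... | inj₂ (inj₂ _)   | no _    | yes v≡b = side-b v≡b
    ... | inj₂ (inj₂ u∼v) | no v≢a  | no v≢b  = rim u∼v v≢a v≢b

    -- The smaller of the two vertices other than `u` in a triangle at `u`: a canonical
    -- representative of that triangle.
    Lower : Fin n → Set
    Lower v = u ∼ v × ∃ λ x → u ∼ x × v ∼ x × v Fin.< x

    lower? : ∀ v → Dec (Lower v)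
    lower? v = (u ∼? v) ×-dec Fin.any? (λ x → (u ∼? x) ×-dec ((v ∼? x) ×-dec (v <? x)))

    lowers : List (Fin n)
    lowers = filter lower? (allFin n)

    -- The number of triangles is read off `G`; comparing orders later identifies it with `κ`.
    t : ℕ
    t = length lowers

    lower-spec : ∀ c → Lower (lookup lowers c)
    lower-spec c = All.lookup (All.all-filter lower? (allFin n)) (∈-lookup c)

    lowers-unique : Unique lowers
    lowers-unique = Unique.filter⁺ lower? (Unique.allFin⁺ n)

    lower : ∀ {v} → Lower v → ∃ λ c → lookup lowers c ≡ v
    lower {v} v-lower = Any.index v∈ , sym (Any.lookup-index v∈)
      where
      v∈ : v ∈ lowers
      v∈ = ∈-filter⁺ lower? (∈-allFin v) v-lower

    tri : Fin t → Fin 2 → Fin n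
    tri c 0F = lookup lowers c
    tri c 1F = proj₁ (proj₂ (lower-spec c))

    other : Fin 2 → Fin 2
    other 0F = 1F
    other 1F = 0F

    u∼tri : ∀ c s → u ∼ tri c s
    u∼tri c 0F = proj₁ (lower-spec c)
    u∼tri c 1F = proj₁ (proj₂ (proj₂ (lower-spec c)))

    tri∼other : ∀ c s → tri c s ∼ tri c (other s)
    tri∼other c 0F = proj₁ (proj₂ (proj₂ (proj₂ (lower-spec c))))
    tri∼other c 1F = symm (tri∼other c 0F)

    lower<upper : ∀ c → tri c 0F Fin.< tri c 1F
    lower<upper c = proj₂ (proj₂ (proj₂ (proj₂ (lower-spec c))))

    tri-partner : ∀ c s {x} → u ∼ x → tri c s ∼ x → x ≡ tri c (other s)
    tri-partner c s u∼x tri∼x = partner-unique (u∼tri c s) u∼x tri∼x (u∼tri c (other s)) (tri∼other c s)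

    -- Otherwise uniqueness of partners would make the two triangles coincide with their ends in
    -- opposite order.
    lower≢upper : ∀ c c′ → tri c 0F ≢ tri c′ 1F
    lower≢upper c c′ eq = Fin.<-asym (subst (Fin._< tri c 1F) eq (lower<upper c))
      (subst (Fin._< tri c′ 1F)
        (tri-partner c 0F (u∼tri c′ 0F) (subst (_∼ tri c′ 0F) (sym eq) (tri∼other c′ 1F))) (lower<upper c′))

    tri-injective : ∀ c s c′ s′ → tri c s ≡ tri c′ s′ → c ≡ c′ × s ≡ s′
    tri-injective c 0F c′ 0F eq = lookup-injective lowers-unique eq , refl
    tri-injective c 0F c′ 1F eq = contradiction eq (lower≢upper c c′)
    tri-injective c 1F c′ 0F eq = contradiction (sym eq) (lower≢upper c′ c)
    tri-injective c 1F c′ 1F eq = lookup-injective lowers-unique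
      (sym (tri-partner c 1F (u∼tri c′ 0F) (subst (_∼ tri c′ 0F) (sym eq) (tri∼other c′ 1F)))) , refl

    tri-adjacent : ∀ c s c′ s′ → tri c s ∼ tri c′ s′ → c ≡ c′
    tri-adjacent c s c′ s′ adjacent =
      sym (proj₁ (tri-injective c′ s′ c (other s) (tri-partner c s (u∼tri c′ s′) adjacent)))

    tri-surjective : ∀ {v} → u ∼ v → v ≢ a → v ≢ b → ∃₂ λ c s → tri c s ≡ v
    tri-surjective {v} u∼v v≢a v≢b with partner u∼v v≢a v≢b
    ... | x , u∼x , v∼x with Fin.<-cmp v x
    ...   | tri< v<x _ _ with lower (u∼v , x , u∼x , v∼x , v<x)
    ...     | c , tri≡v = c , 0F , tri≡v
    tri-surjective {v} u∼v v≢a v≢b | x , u∼x , v∼x | tri≈ _ refl _ = contradiction v∼x (irrefl refl)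
    tri-surjective {v} u∼v v≢a v≢b | x , u∼x , v∼x | tri> _ _ x<v
      with lower (u∼x , v , u∼v , symm v∼x , x<v)
    ... | c , tri≡x = c , 1F , sym (tri-partner c 0F u∼v (subst (_∼ v) (sym tri≡x) (symm v∼x)))

    Label : Set
    Label = Fin (suc (t * 2)) ⊎ Fin 3

    block : Fin (t * 2) → Fin t
    block i = proj₁ (remQuot {t} 2 i)

    end : Fin (t * 2) → Fin 2
    end i = proj₂ (remQuot {t} 2 i)

    -- `punchIn zero` sends 0, 1, 2 to the vertices 1, 2, 3 of the 4-cycle, so the vertex `w`
    -- opposite `u` gets label 1.
    vertex : Label → Fin n
    vertex (inj₁ zero)    = u
    vertex (inj₁ (suc i)) = tri (block i) (end i)
    vertex (inj₂ 0F)      = a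
    vertex (inj₂ 1F)      = w
    vertex (inj₂ 2F)      = b

    u∼rim : ∀ i → u ∼ vertex (inj₁ (suc i))
    u∼rim i = u∼tri (block i) (end i)

    -- Otherwise the other end of its triangle would be a neighbour of `u` adjacent to `a`.
    rim≢a : ∀ i → vertex (inj₁ (suc i)) ≢ a
    rim≢a i rim≡a = isolated-a (u∼tri (block i) (other (end i)))
      (subst (tri (block i) (other (end i)) ∼_) rim≡a (symm (tri∼other (block i) (end i))))

    rim≢b : ∀ i → vertex (inj₁ (suc i)) ≢ b
    rim≢b i rim≡b = isolated-b (u∼tri (block i) (other (end i)))
      (subst (tri (block i) (other (end i)) ∼_) rim≡b (symm (tri∼other (block i) (end i))))

    rim≁w : ∀ i → ¬ (vertex (inj₁ (suc i)) ∼ w)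
    rim≁w i rim∼w = [ rim≢a i , rim≢b i ]′ (neighbour-of-w (symm rim∼w))

    u∼⇒≢w : ∀ {v} → u ∼ v → v ≢ w
    u∼⇒≢w u∼v refl = u≁w u∼v

    remQuot-injective : ∀ i j → block i ≡ block j →
      end i ≡ end j → i ≡ j
    remQuot-injective i j same-block same-end = trans (sym (Fin.combine-remQuot {t} 2 i))
      (trans (cong₂ combine same-block same-end) (Fin.combine-remQuot {t} 2 j))

    vertex-injective : ∀ k l → vertex k ≡ vertex l → k ≡ l
    vertex-injective (inj₁ zero)    (inj₁ zero)    _  = refl
    vertex-injective (inj₁ zero)    (inj₁ (suc j)) eq = contradiction eq (∼⇒≢ (u∼rim j))
    vertex-injective (inj₁ zero)    (inj₂ 0F)      eq = contradiction eq (∼⇒≢ u∼a)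
    vertex-injective (inj₁ zero)    (inj₂ 1F)      eq = contradiction (sym eq) w≢u
    vertex-injective (inj₁ zero)    (inj₂ 2F)      eq = contradiction eq (∼⇒≢ u∼b)
    vertex-injective (inj₁ (suc i)) (inj₁ zero)    eq = contradiction (sym eq) (∼⇒≢ (u∼rim i))
    vertex-injective (inj₁ (suc i)) (inj₁ (suc j)) eq with tri-injective (block i) (end i) (block j) (end j) eq
    ... | same-block , same-end = cong (inj₁ ∘ suc) (remQuot-injective i j same-block same-end)
    vertex-injective (inj₁ (suc i)) (inj₂ 0F)      eq = contradiction eq (rim≢a i)
    vertex-injective (inj₁ (suc i)) (inj₂ 1F)      eq = contradiction eq (u∼⇒≢w (u∼rim i))
    vertex-injective (inj₁ (suc i)) (inj₂ 2F)      eq = contradiction eq (rim≢b i)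
    vertex-injective (inj₂ 0F)      (inj₁ zero)    eq = contradiction (sym eq) (∼⇒≢ u∼a)
    vertex-injective (inj₂ 0F)      (inj₁ (suc j)) eq = contradiction (sym eq) (rim≢a j)
    vertex-injective (inj₂ 0F)      (inj₂ 0F)      eq = refl
    vertex-injective (inj₂ 0F)      (inj₂ 1F)      eq = contradiction eq (u∼⇒≢w u∼a)
    vertex-injective (inj₂ 0F)      (inj₂ 2F)      eq = contradiction eq a≢b
    vertex-injective (inj₂ 1F)      (inj₁ zero)    eq = contradiction eq w≢u
    vertex-injective (inj₂ 1F)      (inj₁ (suc j)) eq = contradiction (sym eq) (u∼⇒≢w (u∼rim j))
    vertex-injective (inj₂ 1F)      (inj₂ 0F)      eq = contradiction (sym eq) (u∼⇒≢w u∼a)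
    vertex-injective (inj₂ 1F)      (inj₂ 1F)      eq = refl
    vertex-injective (inj₂ 1F)      (inj₂ 2F)      eq = contradiction (sym eq) (u∼⇒≢w u∼b)
    vertex-injective (inj₂ 2F)      (inj₁ zero)    eq = contradiction (sym eq) (∼⇒≢ u∼b)
    vertex-injective (inj₂ 2F)      (inj₁ (suc j)) eq = contradiction (sym eq) (rim≢b j)
    vertex-injective (inj₂ 2F)      (inj₂ 0F)      eq = contradiction (sym eq) a≢b
    vertex-injective (inj₂ 2F)      (inj₂ 1F)      eq = contradiction eq (u∼⇒≢w u∼b)
    vertex-injective (inj₂ 2F)      (inj₂ 2F)      eq = refl

    vertex-surjective : ∀ v → ∃ λ k → vertex k ≡ v
    vertex-surjective v with classify v
    ... | centre v≡u = inj₁ zero , sym v≡u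
    ... | apex v≡w   = inj₂ 1F , sym v≡w
    ... | side-a v≡a = inj₂ 0F , sym v≡a
    ... | side-b v≡b = inj₂ 2F , sym v≡b
    ... | rim u∼v v≢a v≢b with tri-surjective u∼v v≢a v≢b
    ...   | c , s , tri≡v = inj₁ (suc (combine c s)) ,
            trans (cong (λ (c , s) → tri c s) (Fin.remQuot-combine c s)) tri≡v

    H : Graph (suc (t * 2) + 3)
    H = triangles∙C₄ t

    rim-adjacency : ∀ i j → (i ≢ j × block i ≡ block j) ⇔
      (vertex (inj₁ (suc i)) ∼ vertex (inj₁ (suc j)))
    rim-adjacency i j = mk⇔ to from
      where
      ends : ∀ c s s′ → s ≢ s′ → tri c s ∼ tri c s′
      ends c 0F 0F s≢s′ = contradiction refl s≢s′
      ends c 0F 1F _    = tri∼other c 0F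
      ends c 1F 0F _    = tri∼other c 1F
      ends c 1F 1F s≢s′ = contradiction refl s≢s′
      to : i ≢ j × block i ≡ block j → vertex (inj₁ (suc i)) ∼ vertex (inj₁ (suc j))
      to (i≢j , same-block) = subst (λ c → vertex (inj₁ (suc i)) ∼ tri c (end j)) same-block
        (ends (block i) (end i) (end j) (i≢j ∘ remQuot-injective i j same-block))
      from : vertex (inj₁ (suc i)) ∼ vertex (inj₁ (suc j)) → i ≢ j × block i ≡ block j
      from adjacent = (λ { refl → irrefl refl adjacent }) , tri-adjacent (block i) (end i) (block j) (end j) adjacent

    both : ∀ {P Q : Set} → P → Q → P ⇔ Q
    both p q = mk⇔ (λ _ → q) (λ _ → p)

    neither : ∀ {P Q : Set} → ¬ P → ¬ Q → P ⇔ Q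
    neither ¬p ¬q = mk⇔ (λ p → contradiction p ¬p) (λ q → contradiction q ¬q)

    adjacency : ∀ x y → (Graph._∼_ H x y) ⇔ (vertex (splitAt (suc (t * 2)) x) ∼ vertex (splitAt (suc (t * 2)) y))
    adjacency x y with splitAt (suc (t * 2)) x | splitAt (suc (t * 2)) y
    ... | inj₁ zero    | inj₁ zero    = neither id (irrefl refl)
    ... | inj₁ zero    | inj₁ (suc j) = both tt (u∼rim j)
    ... | inj₁ (suc i) | inj₁ zero    = both tt (symm (u∼rim i))
    ... | inj₁ (suc i) | inj₁ (suc j) = rim-adjacency i j
    ... | inj₁ zero    | inj₂ 0F      = both (refl , toWitness {a? = Graph._∼?_ (cycle 4) 0F 1F} tt) u∼a
    ... | inj₁ zero    | inj₂ 1F      = neither (toWitnessFalse {a? = Graph._∼?_ (cycle 4) 0F 2F} tt ∘ proj₂) u≁w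
    ... | inj₁ zero    | inj₂ 2F      = both (refl , toWitness {a? = Graph._∼?_ (cycle 4) 0F 3F} tt) u∼b
    ... | inj₁ (suc i) | inj₂ 0F      = neither (λ ()) (isolated-a (u∼rim i))
    ... | inj₁ (suc i) | inj₂ 1F      = neither (λ ()) (rim≁w i)
    ... | inj₁ (suc i) | inj₂ 2F      = neither (λ ()) (isolated-b (u∼rim i))
    ... | inj₂ 0F      | inj₁ zero    = both (refl , toWitness {a? = Graph._∼?_ (cycle 4) 0F 1F} tt) (symm u∼a)
    ... | inj₂ 1F      | inj₁ zero    = neither (toWitnessFalse {a? = Graph._∼?_ (cycle 4) 0F 2F} tt ∘ proj₂) (u≁w ∘ symm)
    ... | inj₂ 2F      | inj₁ zero    = both (refl , toWitness {a? = Graph._∼?_ (cycle 4) 0F 3F} tt) (symm u∼b)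
    ... | inj₂ 0F      | inj₁ (suc j) = neither (λ ()) (isolated-a (u∼rim j) ∘ symm)
    ... | inj₂ 1F      | inj₁ (suc j) = neither (λ ()) (rim≁w j ∘ symm)
    ... | inj₂ 2F      | inj₁ (suc j) = neither (λ ()) (isolated-b (u∼rim j) ∘ symm)
    ... | inj₂ 0F      | inj₂ 0F      = neither (Graph.irrefl (cycle 4) refl) (irrefl refl)
    ... | inj₂ 0F      | inj₂ 1F      = both (toWitness {a? = Graph._∼?_ (cycle 4) 1F 2F} tt) (symm w∼a)
    ... | inj₂ 0F      | inj₂ 2F      = neither (toWitnessFalse {a? = Graph._∼?_ (cycle 4) 1F 3F} tt) (isolated-b u∼a)
    ... | inj₂ 1F      | inj₂ 0F      = both (toWitness {a? = Graph._∼?_ (cycle 4) 2F 1F} tt) w∼a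
    ... | inj₂ 1F      | inj₂ 1F      = neither (Graph.irrefl (cycle 4) refl) (irrefl refl)
    ... | inj₂ 1F      | inj₂ 2F      = both (toWitness {a? = Graph._∼?_ (cycle 4) 2F 3F} tt) w∼b
    ... | inj₂ 2F      | inj₂ 0F      = neither (toWitnessFalse {a? = Graph._∼?_ (cycle 4) 3F 1F} tt) (isolated-a u∼b)
    ... | inj₂ 2F      | inj₂ 1F      = both (toWitness {a? = Graph._∼?_ (cycle 4) 3F 2F} tt) (symm w∼b)
    ... | inj₂ 2F      | inj₂ 2F      = neither (Graph.irrefl (cycle 4) refl) (irrefl refl)

    isomorphism : G ≅ H
    isomorphism = mk↔ₛ′ to from to-from from-to , λ v v′ → mk⇔
        (λ v∼v′ → Equivalence.from (adjacency (to v) (to v′)) (subst₂ _∼_ (sym (from-to v)) (sym (from-to v′)) v∼v′))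
        (λ v∼v′ → subst₂ _∼_ (from-to v) (from-to v′) (Equivalence.to (adjacency (to v) (to v′)) v∼v′))
      where
      label : Fin n → Label
      label v = proj₁ (vertex-surjective v)
      vertex-label : ∀ v → vertex (label v) ≡ v
      vertex-label v = proj₂ (vertex-surjective v)
      to : Fin n → Fin (suc (t * 2) + 3)
      to v = join (suc (t * 2)) 3 (label v)
      from : Fin (suc (t * 2) + 3) → Fin n
      from x = vertex (splitAt (suc (t * 2)) x)
      from-to : ∀ v → from (to v) ≡ v
      from-to v = trans (cong vertex {splitAt (suc (t * 2)) (to v)} {label v} (Fin.splitAt-join (suc (t * 2)) 3 (label v))) (vertex-label v)
      to-from : ∀ x → to (from x) ≡ x
      to-from x = trans (cong (join (suc (t * 2)) 3) (vertex-injective (label (from x)) (splitAt (suc (t * 2)) x) (vertex-label (from x))))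
        (Fin.join-splitAt (suc (t * 2)) 3 x)

    order≡ : n ≡ suc (t * 2) + 3
    order≡ = ↔⇒≡ (proj₁ isomorphism)

-- The signless Laplacian as an operator, and the positive eigenvector of H.

module Spectra where
  open RealArithmetic
  open RealAnalysis
  open QuarticRoots
  open GraphCounting using (sum; module Adjacency)
  open ExtremalDegrees using (TrianglesAndCycle)
  open Recognition using (module Structure)
  open import Data.Bool using (true; false; if_then_else_)
  open import Data.Fin using (Fin; zero; suc; _≟_)
  open import Data.Integer using (+_)
  open import Data.Nat as ℕ using (ℕ; zero; suc)
  open import Data.Product using (∃; _×_; _,_; proj₂)
  open import Data.Sum using (_⊎_; inj₁; inj₂; [_,_]′)
  open import Function using (_∘_)
  open import Relation.Binary.PropositionalEquality as ≡ using (_≡_; _≢_)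
  open import Relation.Nullary using (¬_; Dec; yes; no; does; contradiction)

  if-yes : ∀ {P A : Set} (P? : Dec P) {x y : A} → P → (if does P? then x else y) ≡ x
  if-yes (yes _) p = ≡.refl
  if-yes (no ¬p) p = contradiction p ¬p

  if-no : ∀ {P A : Set} (P? : Dec P) {x y : A} → ¬ P → (if does P? then x else y) ≡ y
  if-no (yes p) ¬p = contradiction p ¬p
  if-no (no _)  ¬p = ≡.refl

  module Spectrum (ℝ : RealNumbers) where
    open OrderedField ℝ
    open ≈-Reasoning

    -- A row of the degree matrix unfolds to this form, with the degree as `c`.
    point : ∀ {n} → Fin n → Carrier → Fin n → Carrier
    point i c j = if does (i ≟ j) then c else 0#

    point-yes : ∀ {n} {i j : Fin n} {c} → i ≡ j → point i c j ≈ c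
    point-yes {i = i} {j} i≡j = reflexive (if-yes (i ≟ j) i≡j)

    point-no : ∀ {n} {i j : Fin n} {c} → i ≢ j → point i c j ≈ 0#
    point-no {i = i} {j} i≢j = reflexive (if-no (i ≟ j) i≢j)

    sum-zero : ∀ {n} → ∑ {n} (λ _ → 0#) ≈ 0#
    sum-zero {zero}  = refl
    sum-zero {suc n} = trans (+-identityˡ _) (sum-zero {n})

    sum-point : ∀ {n} (i : Fin n) c → ∑ (point i c) ≈ c
    sum-point {suc n} zero    c = trans (+-congˡ (sum-zero {n})) (+-identityʳ c)
    sum-point {suc n} (suc i) c = trans (+-identityˡ _) (sum-point i c)

    sum-const : ∀ n c → ∑ {n} (λ _ → c) ≈ ι n * c
    sum-const zero    c = sym (zeroˡ c)
    sum-const (suc n) c = trans (+-cong (sym (*-identityˡ c)) (sum-const n c)) (sym (distribʳ c 1# (ι n)))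

    ι-sum : ∀ {n} (f : Fin n → ℕ) → ι (sum f) ≈ ∑ (λ i → ι (f i))
    ι-sum {zero}  f = refl
    ι-sum {suc n} f = trans (ι-+ (f zero) _) (+-congˡ (ι-sum (f ∘ suc)))

    module _ {n : ℕ} (G : Graph n) where
      open Adjacency G

      A : Matrix ℝ n
      A = adjacencyMatrix ℝ G

      A-yes : ∀ {i j} → i ∼ j → A i j ≈ 1#
      A-yes {i} {j} i∼j = reflexive (if-yes (i ∼? j) i∼j)

      A-no : ∀ {i j} → ¬ (i ∼ j) → A i j ≈ 0#
      A-no {i} {j} i≁j = reflexive (if-no (i ∼? j) i≁j)

      ι-e : ∀ i j → ι (e i j) ≈ A i j
      ι-e i j with i ∼? j
      ... | yes _ = +-identityʳ 1#
      ... | no _  = refl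

      A-symm : ∀ i j → A i j ≈ A j i
      A-symm i j = trans (sym (ι-e i j)) (trans (reflexive (≡.cong ι (e-symm i j))) (ι-e j i))

      0≤A : ∀ i j → 0# ≤ A i j
      0≤A i j = ≤-respʳ-≈ (ι-e i j) (0≤ι (e i j))

      open WeightedBound ℝ A A-symm 0≤A public using (action; eigenvalue-bound)

      signlessLaplacian-action : ∀ x i → ∑ (λ j → signlessLaplacian ℝ G i j * x j) ≈ action x i
      signlessLaplacian-action x i = begin
        ∑ (λ j → (point i (ι (degree G i)) j + A i j) * x j)
          ≈⟨ sum-cong (λ j → trans (distribʳ (x j) _ _) (+-congʳ (diagonal j))) ⟩
        ∑ (λ j → point i (ι (degree G i) * x i) j + A i j * x j)
          ≈⟨ ∑-distrib-+ (point i (ι (degree G i) * x i)) _ ⟩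
        ∑ (point i (ι (degree G i) * x i)) + ∑ (λ j → A i j * x j)
          ≈⟨ +-congʳ (trans (sum-point i _) row-sum) ⟩
        ∑ (λ j → A i j * x i) + ∑ (λ j → A i j * x j)
          ≈⟨ ∑-distrib-+ (λ j → A i j * x i) _ ⟨
        ∑ (λ j → A i j * x i + A i j * x j)
          ≈⟨ sum-cong (λ j → sym (distribˡ (A i j) (x i) (x j))) ⟩
        action x i ∎
        where
        diagonal : ∀ j → point i (ι (degree G i)) j * x j ≈ point i (ι (degree G i) * x i) j
        diagonal j with i ≟ j
        ... | yes ≡.refl = refl
        ... | no _       = zeroˡ (x j)
        row-sum : ι (degree G i) * x i ≈ ∑ (λ j → A i j * x i)
        row-sum = begin
          ι (degree G i) * x i               ≈⟨ *-congʳ (reflexive (≡.cong ι (degree≡deg i))) ⟩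
          ι (deg i) * x i                    ≈⟨ *-congʳ (trans (ι-sum (e i)) (sum-cong (ι-e i))) ⟩
          ∑ (A i) * x i                      ≈⟨ *-comm _ _ ⟩
          x i * ∑ (A i)                      ≈⟨ *-distribˡ-∑ {n} (x i) (A i) ⟩
          ∑ (λ j → x i * A i j)              ≈⟨ sum-cong (λ j → *-comm (x i) (A i j)) ⟩
          ∑ (λ j → A i j * x i)              ∎

      radius-bound : ∀ {q} → IsSignlessLaplacianRadius ℝ G q → ∀ x → (∀ i → 0# < x i) → ∀ {c L} → 0# ≤ c →
        (∀ i → c * action x i ≤ L * x i) → c * q ≤ L
      radius-bound {q} ((v , nonzero , eigen) , _) x 0<x 0≤c bound =
        eigenvalue-bound x 0<x 0≤c bound v nonzero
          (λ i → trans (sym (signlessLaplacian-action v i)) (eigen i))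

      -- Used as its own weight, the positive eigenvector gives `q ≤ μ`; conversely `μ` is an
      -- eigenvalue and `q` the largest one.
      positive-eigenvector⇒radius : ∀ {q μ} → IsSignlessLaplacianRadius ℝ G q → Fin n → ∀ x → (∀ i → 0# < x i) →
        (∀ i → action x i ≈ μ * x i) → q ≈ μ
      positive-eigenvector⇒radius {q} {μ} radius i₀ x 0<x eigen = ≤-antisym
        (≤-respˡ-≈ (*-identityˡ q) (radius-bound radius x 0<x (<⇒≤ (<-respʳ-≈ (+-identityʳ 1#) (0<ι 1)))
          (λ i → ≤-reflexive (trans (*-identityˡ _) (eigen i)))))
        (proj₂ radius μ (x , (i₀ , #-sym (<⇒# (0<x i₀))) ,
          λ i → trans (signlessLaplacian-action x i) (eigen i)))

      two-neighbour-row : ∀ {v p q} (f : Fin n → Carrier) → p ≢ q → v ∼ p → v ∼ q →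
        (∀ {x} → v ∼ x → x ≡ p ⊎ x ≡ q) → ∑ (λ x → A v x * f x) ≈ f p + f q
      two-neighbour-row {v} {p} {q} f p≢q v∼p v∼q only = begin
        ∑ (λ x → A v x * f x)                                ≈⟨ sum-cong term ⟩
        ∑ (λ x → point p (f p) x + point q (f q) x)          ≈⟨ ∑-distrib-+ (point p (f p)) _ ⟩
        ∑ (point p (f p)) + ∑ (point q (f q))                ≈⟨ +-cong (sum-point p (f p)) (sum-point q (f q)) ⟩
        f p + f q                                            ∎
        where
        term : ∀ x → A v x * f x ≈ point p (f p) x + point q (f q) x
        term x with p ≟ x | q ≟ x
        ... | yes ≡.refl | yes ≡.refl = contradiction ≡.refl p≢q
        ... | yes ≡.refl | no _       = trans (trans (*-congʳ (A-yes v∼p)) (*-identityˡ (f p))) (sym (+-identityʳ (f p)))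
        ... | no _       | yes ≡.refl = trans (trans (*-congʳ (A-yes v∼q)) (*-identityˡ (f q))) (sym (+-identityˡ (f q)))
        ... | no p≢x     | no q≢x     = trans (trans (*-congʳ (A-no (λ v∼x →
          [ (λ x≡p → p≢x (≡.sym x≡p)) , (λ x≡q → q≢x (≡.sym x≡q)) ]′ (only v∼x)))) (zeroˡ (f x))) (sym (+-identityʳ 0#))

    module Eigenvector {n : ℕ} {G : Graph n} (S : TrianglesAndCycle G) (κ : ℕ) (order : n ≡ 2 ℕ.* κ ℕ.+ 4)
        (q : Carrier) (2<q-2 : ι 2 < q - ι 2) (cubic≈0 : LargestRoot.cubic ℝ κ (q - ι 2) ≈ 0#) where
      open Graph G
      open Structure S
      open LargestRoot ℝ κ using (y≈)

      -- The values at the centre (`Z`), the rim (`T`), the sides `a`, `b` (`B`) and the apex (`W`).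
      -- They solve `(U - 1) T = Z` at the rim, `U B = Z + W` at the sides and `U W = 2 B` at the
      -- apex without denominators, so only the centre row constrains `q`.
      U Z T B W : Carrier
      U = q - ι 2
      Z = (U - ι 1) * (U * U - ι 2)
      T = U * U - ι 2
      B = U * (U - ι 1)
      W = ι 2 * (U - ι 1)

      X : Fin n → Carrier
      X v = if does (v ≟ u) then Z else if does (v ≟ w) then W else
            if does (v ≟ a) then B else if does (v ≟ b) then B else T

      u≢w : u ≢ w
      u≢w u≡w = w≢u (≡.sym u≡w)

      u∼⇒≢u : ∀ {v} → u ∼ v → v ≢ u
      u∼⇒≢u u∼v ≡.refl = irrefl ≡.refl u∼v

      X-u : X u ≈ Z
      X-u = reflexive (if-yes (u ≟ u) ≡.refl)

      X-w : X w ≈ W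
      X-w = reflexive (≡.trans (if-no (w ≟ u) w≢u) (if-yes (w ≟ w) ≡.refl))

      X-a : X a ≈ B
      X-a = reflexive (≡.trans (if-no (a ≟ u) (u∼⇒≢u u∼a)) (≡.trans (if-no (a ≟ w) (u∼⇒≢w u∼a)) (if-yes (a ≟ a) ≡.refl)))

      X-b : X b ≈ B
      X-b = reflexive (≡.trans (if-no (b ≟ u) (u∼⇒≢u u∼b)) (≡.trans (if-no (b ≟ w) (u∼⇒≢w u∼b))
        (≡.trans (if-no (b ≟ a) (λ b≡a → a≢b (≡.sym b≡a))) (if-yes (b ≟ b) ≡.refl))))

      X-rim : ∀ {v} → u ∼ v → v ≢ a → v ≢ b → X v ≈ T
      X-rim {v} u∼v v≢a v≢b = reflexive (≡.trans (if-no (v ≟ u) (u∼⇒≢u u∼v)) (≡.trans (if-no (v ≟ w) (u∼⇒≢w u∼v))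
        (≡.trans (if-no (v ≟ a) v≢a) (if-no (v ≟ b) v≢b))))

      0<X : ∀ v → 0# < X v
      0<X v = if-pos (does (v ≟ u)) (*-pos 0<U-1 0<T) (if-pos (does (v ≟ w)) (*-pos (0<ι 2) 0<U-1)
        (if-pos (does (v ≟ a)) 0<B (if-pos (does (v ≟ b)) 0<B 0<T)))
        where
        if-pos : ∀ c {x y} → 0# < x → 0# < y → 0# < (if c then x else y)
        if-pos true  0<x _ = 0<x
        if-pos false _ 0<y = 0<y
        0<U : 0# < U
        0<U = <-trans (0<ι 2) 2<q-2
        0<U-2 : 0# < U - ι 2
        0<U-2 = x<y⇒0<y-x 2<q-2
        0<U-1 : 0# < U - ι 1
        0<U-1 = <-respʳ-≈ (solve 1 (λ U → (U :- con (+ 2)) :+ con (+ 1) := U :- con (+ 1)) refl U) (+-pos 0<U-2 (0<ι 1))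
        0<T : 0# < T
        0<T = <-respʳ-≈ (solve 1 (λ U → (U :- con (+ 2)) :* (U :+ con (+ 2)) :+ con (+ 2) := U :* U :- con (+ 2)) refl U)
          (+-pos (*-pos 0<U-2 (+-pos 0<U (0<ι 2))) (0<ι 2))
        0<B : 0# < B
        0<B = *-pos 0<U 0<U-1

      -- The summand is the constant `Z + T` on all `n` vertices, corrected at `a`, `b`, `u` and
      -- `w`, so the rim need not be counted separately. What is left over is `U` times the cubic.
      centre-row : ∑ (λ x → A G u x * (X u + X x)) ≈ q * X u
      centre-row = begin
        ∑ (λ x → A G u x * (X u + X x))
          ≈⟨ sum-cong term ⟩
        ∑ (λ x → Z + T + (point a (B - T) x + (point b (B - T) x + (point u (- (Z + T)) x + point w (- (Z + T)) x))))
          ≈⟨ trans (∑-distrib-+ {n} (λ _ → Z + T) _) (+-cong (sum-const n (Z + T))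
             (trans (∑-distrib-+ (point a (B - T)) _) (+-cong (sum-point a _)
             (trans (∑-distrib-+ (point b (B - T)) _) (+-cong (sum-point b _)
             (trans (∑-distrib-+ (point u (- (Z + T))) _) (+-cong (sum-point u _) (sum-point w _)))))))) ⟩
        ι n * (Z + T) + ((B - T) + ((B - T) + (- (Z + T) + - (Z + T))))
          ≈⟨ +-congʳ (*-congʳ (trans (reflexive (≡.cong ι order)) (trans (ι-+ (2 ℕ.* κ) 4) (+-congʳ (ι-* 2 κ))))) ⟩
        (ι 2 * ι κ + ι 4) * (Z + T) + ((B - T) + ((B - T) + (- (Z + T) + - (Z + T))))
          ≈⟨ solve 2 (λ q k →
               let U = q :- con (+ 2)
                   Z = (U :- con (+ 1)) :* (U :* U :- con (+ 2))
                   T = U :* U :- con (+ 2)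
                   B = U :* (U :- con (+ 1))
               in (con (+ 2) :* k :+ con (+ 4)) :* (Z :+ T) :+ ((B :- T) :+ ((B :- T) :+ (:- (Z :+ T) :+ :- (Z :+ T))))
                  := q :* Z :- U :* ((U :- (con (+ 1) :+ con (+ 2) :* k)) :* (U :* U :- con (+ 2)) :- con (+ 2) :* (U :- con (+ 1))))
               refl q (ι κ) ⟩
        q * Z - U * ((U - (ι 1 + ι 2 * ι κ)) * (U * U - ι 2) - ι 2 * (U - ι 1))
          ≈⟨ +-congˡ (-‿cong (*-congˡ (trans (+-congʳ (*-congʳ (+-congˡ (-‿cong (sym y≈))))) cubic≈0))) ⟩
        q * Z - U * 0#
          ≈⟨ solve 2 (λ z u → z :- u :* con (+ 0) := z) refl (q * Z) U ⟩
        q * Z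
          ≈⟨ *-congˡ X-u ⟨
        q * X u ∎
        where
        a≢ : ∀ {x} → x ≢ a → a ≢ x
        a≢ x≢a a≡x = x≢a (≡.sym a≡x)
        b≢ : ∀ {x} → x ≢ b → b ≢ x
        b≢ x≢b b≡x = x≢b (≡.sym b≡x)
        term : ∀ x → A G u x * (X u + X x) ≈
          Z + T + (point a (B - T) x + (point b (B - T) x + (point u (- (Z + T)) x + point w (- (Z + T)) x)))
        term x with classify x
        ... | centre ≡.refl = trans (trans (*-congʳ (A-no G (irrefl ≡.refl))) (zeroˡ _))
          (trans (solve 1 (λ z → con (+ 0) := z :+ (con (+ 0) :+ (con (+ 0) :+ (:- z :+ con (+ 0))))) refl (Z + T))
            (+-congˡ (sym (+-cong (point-no (u∼⇒≢u u∼a)) (+-cong (point-no (u∼⇒≢u u∼b))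
              (+-cong (point-yes {i = u} ≡.refl) (point-no w≢u)))))))
        ... | apex ≡.refl = trans (trans (*-congʳ (A-no G u≁w)) (zeroˡ _))
          (trans (solve 1 (λ z → con (+ 0) := z :+ (con (+ 0) :+ (con (+ 0) :+ (con (+ 0) :+ :- z)))) refl (Z + T))
            (+-congˡ (sym (+-cong (point-no (u∼⇒≢w u∼a)) (+-cong (point-no (u∼⇒≢w u∼b))
              (+-cong (point-no u≢w) (point-yes {i = w} ≡.refl)))))))
        ... | side-a ≡.refl = trans (*-cong (A-yes G u∼a) (+-cong X-u X-a))
          (trans (trans (*-identityˡ _) (solve 3 (λ z t b → z :+ b := z :+ t :+ ((b :- t) :+ (con (+ 0) :+ (con (+ 0) :+ con (+ 0))))) refl Z T B))
            (+-congˡ (sym (+-cong (point-yes {i = a} ≡.refl) (+-cong (point-no (b≢ a≢b))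
              (+-cong (point-no (λ u≡a → u∼⇒≢u u∼a (≡.sym u≡a))) (point-no (λ w≡a → u∼⇒≢w u∼a (≡.sym w≡a)))))))))
        ... | side-b ≡.refl = trans (*-cong (A-yes G u∼b) (+-cong X-u X-b))
          (trans (trans (*-identityˡ _) (solve 3 (λ z t b → z :+ b := z :+ t :+ (con (+ 0) :+ ((b :- t) :+ (con (+ 0) :+ con (+ 0))))) refl Z T B))
            (+-congˡ (sym (+-cong (point-no a≢b) (+-cong (point-yes {i = b} ≡.refl)
              (+-cong (point-no (λ u≡b → u∼⇒≢u u∼b (≡.sym u≡b))) (point-no (λ w≡b → u∼⇒≢w u∼b (≡.sym w≡b)))))))))
        ... | rim u∼x x≢a x≢b = trans (*-cong (A-yes G u∼x) (+-cong X-u (X-rim u∼x x≢a x≢b)))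
          (trans (trans (*-identityˡ _) (solve 1 (λ z → z := z :+ (con (+ 0) :+ (con (+ 0) :+ (con (+ 0) :+ con (+ 0))))) refl (Z + T)))
            (+-congˡ (sym (+-cong (point-no (a≢ x≢a)) (+-cong (point-no (b≢ x≢b))
              (+-cong (point-no (λ u≡x → u∼⇒≢u u∼x (≡.sym u≡x))) (point-no (λ w≡x → u∼⇒≢w u∼x (≡.sym w≡x)))))))))

      side-row : ∀ {c} → X c ≈ B → u ∼ c → w ∼ c → (∀ {v} → u ∼ v → ¬ (v ∼ c)) → action G X c ≈ q * X c
      side-row {c} X-c u∼c w∼c isolated = begin
        action G X c              ≈⟨ two-neighbour-row G (λ x → X c + X x) u≢w (symm u∼c) (symm w∼c) only ⟩
        X c + X u + (X c + X w)   ≈⟨ +-cong (+-cong X-c X-u) (+-cong X-c X-w) ⟩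
        B + Z + (B + W)           ≈⟨ solve 1 (λ q → let U = q :- con (+ 2) ; W = con (+ 2) :* (U :- con (+ 1)) ; B = U :* (U :- con (+ 1))
                                                        Z = (U :- con (+ 1)) :* (U :* U :- con (+ 2))
                                       in B :+ Z :+ (B :+ W) := q :* B) refl q ⟩
        q * B                     ≈⟨ *-congˡ X-c ⟨
        q * X c                   ∎
        where
        only : ∀ {x} → c ∼ x → x ≡ u ⊎ x ≡ w
        only {x} c∼x with cover x
        ... | inj₁ x≡u        = inj₁ x≡u
        ... | inj₂ (inj₁ x≡w) = inj₂ x≡w
        ... | inj₂ (inj₂ u∼x) = contradiction (symm c∼x) (isolated u∼x)

      rim-row : ∀ {v} → u ∼ v → v ≢ a → v ≢ b → (∃ λ p → u ∼ p × v ∼ p) → action G X v ≈ q * X v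
      rim-row {v} u∼v v≢a v≢b (p , u∼p , v∼p) = begin
        action G X v              ≈⟨ two-neighbour-row G (λ x → X v + X x) (λ u≡p → u∼⇒≢u u∼p (≡.sym u≡p)) (symm u∼v) v∼p only ⟩
        X v + X u + (X v + X p)   ≈⟨ +-cong (+-cong X-v X-u) (+-cong X-v X-p) ⟩
        T + Z + (T + T)           ≈⟨ solve 1 (λ q → let U = q :- con (+ 2) ; T = U :* U :- con (+ 2)
                                                        Z = (U :- con (+ 1)) :* (U :* U :- con (+ 2))
                                       in T :+ Z :+ (T :+ T) := q :* T) refl q ⟩
        q * T                     ≈⟨ *-congˡ X-v ⟨
        q * X v                   ∎
        where
        X-v : X v ≈ T
        X-v = X-rim u∼v v≢a v≢b
        X-p : X p ≈ T
        X-p = X-rim u∼p (λ { ≡.refl → isolated-a u∼v v∼p }) (λ { ≡.refl → isolated-b u∼v v∼p })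
        only : ∀ {x} → v ∼ x → x ≡ u ⊎ x ≡ p
        only {x} v∼x with cover x
        ... | inj₁ x≡u           = inj₁ x≡u
        ... | inj₂ (inj₁ ≡.refl) = contradiction (neighbour-of-w (symm v∼x)) [ v≢a , v≢b ]′
        ... | inj₂ (inj₂ u∼x)    = inj₂ (partner-unique u∼v u∼x v∼x u∼p v∼p)

      eigen : ∀ v → action G X v ≈ q * X v
      eigen v with classify v
      ... | centre ≡.refl = centre-row
      ... | apex ≡.refl = begin
        action G X w              ≈⟨ two-neighbour-row G (λ x → X w + X x) a≢b w∼a w∼b neighbour-of-w ⟩
        X w + X a + (X w + X b)   ≈⟨ +-cong (+-cong X-w X-a) (+-cong X-w X-b) ⟩
        W + B + (W + B)           ≈⟨ solve 1 (λ q → let U = q :- con (+ 2) ; W = con (+ 2) :* (U :- con (+ 1)) ; B = U :* (U :- con (+ 1))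
                                       in W :+ B :+ (W :+ B) := q :* W) refl q ⟩
        q * W                     ≈⟨ *-congˡ X-w ⟨
        q * X w                   ∎
      ... | side-a ≡.refl = side-row X-a u∼a w∼a isolated-a
      ... | side-b ≡.refl = side-row X-b u∼b w∼b isolated-b
      ... | rim u∼v v≢a v≢b = rim-row u∼v v≢a v≢b (partner u∼v v≢a v≢b)

-- Comparison of the two radii and the equality case.

module Comparisons where
  open RealArithmetic using (module OrderedField)
  open QuarticRoots using (module LargestRoot)
  open GraphCounting
  open ExtremalDegrees using (module DegreeBound; TrianglesAndCycle)
  open Recognition using (triangles∙C₄; module Structure)
  open Spectra using (module Spectrum)
  open import Data.Fin as Fin using (Fin; zero; suc; _≟_; _↑ʳ_; splitAt)
  import Data.Fin.Properties as Fin
  open import Data.Fin.Patterns using (0F; 1F; 2F; 3F)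
  open import Data.Fin.Permutation using (↔⇒≡)
  open import Data.List using ([]; _∷_)
  open import Data.List.Relation.Unary.All using ([]; _∷_)
  open import Data.List.Relation.Unary.AllPairs using ([]; _∷_)
  open import Data.Nat using (ℕ; zero; suc; _∸_; z≤n; s≤s) renaming (_+_ to _+ℕ_; _*_ to _*ℕ_; _≤_ to _≤ℕ_; _<_ to _<ℕ_; _<?_ to _<ℕ?_)
  import Data.Nat.Properties as ℕ
  open import Data.Nat.DivMod using (_/_; m*n/n≡m)
  open import Data.Nat.Tactic.RingSolver using (solve-∀)
  open import Data.Product using (∃; _×_; _,_; proj₁; proj₂)
  open import Data.Sum using (_⊎_; inj₁; inj₂)
  open import Data.Unit using (tt)
  open import Function.Bundles using (_⇔_; mk⇔; Inverse; Equivalence)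
  open import Relation.Binary.Construct.Closure.ReflexiveTransitive using (Star; ε; _◅_)
  open import Relation.Binary.PropositionalEquality
  open import Relation.Nullary using (Dec; yes; no; contradiction)
  open import Relation.Nullary.Decidable using (toWitness)
  open import Data.Integer using (+_)

  sum-deg-positive : ∀ {n} (G : Graph n) → 1 ≤ℕ size G → ∃ λ i → ∃ λ j → Graph._∼_ G i j
  sum-deg-positive G 1≤size = i , proj₁ ∃j , 1≤e⇒∼ (proj₂ ∃j)
    where
    open Adjacency G
    ∃i = sum-positive deg (subst (1 ≤ℕ_) (sym handshake) (ℕ.≤-trans 1≤size (ℕ.m≤m+n (size G) _)))
    i = proj₁ ∃i
    ∃j = sum-positive (e i) (proj₂ ∃i)

  -- A walk from `v` to an end of some edge starts with a neighbour of `v`, or is empty and `v` lies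
  -- on that edge. Thus the degree is not 0, and it is not 1 by assumption.
  2≤deg : ∀ {n} (G : Graph n) → Connected G → 1 ≤ℕ size G → NoPendantVertex G → ∀ v → 2 ≤ℕ Adjacency.deg G v
  2≤deg G connected 1≤size no-pendant v = ℕ.≤∧≢⇒< 1≤deg (λ 1≡deg → no-pendant v (trans (degree≡deg v) (sym 1≡deg)))
    where
    open Adjacency G
    neighbour : ∀ {i j} → i ∼ j → Star _∼_ v i → ∃ λ x → v ∼ x
    neighbour {j = j} i∼j ε  = j , i∼j
    neighbour _ (v∼x ◅ _)    = _ , v∼x
    ∃x : ∃ λ x → v ∼ x
    ∃x with sum-deg-positive G 1≤size
    ... | i , _ , i∼j = neighbour i∼j (connected v i)
    1≤deg : 1 ≤ℕ deg v
    1≤deg = subst (_≤ℕ deg v) (trans (ℕ.+-identityʳ _) (edge (proj₂ ∃x))) (sum-unique-≤ (e v) {proj₁ ∃x ∷ []} ([] ∷ []))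

  two-missed⇒order≤ : ∀ {n} (G : Graph n) {u w} → (∀ x → x ≡ u ⊎ x ≡ w ⊎ Graph._∼_ G u x) → n ≤ℕ Adjacency.deg G u +ℕ 2
  two-missed⇒order≤ {n} G {u} {w} cover = begin
    n                                                           ≡⟨ sum-ones n ⟨
    sum {n} (λ _ → 1)                                           ≤⟨ sum-mono covered ⟩
    sum (λ x → e u x +ℕ (𝟙 (x ≟ u) *ℕ 1 +ℕ 𝟙 (x ≟ w) *ℕ 1))      ≡⟨ ∑-distrib-+ (e u) _ ⟩
    deg u +ℕ sum (λ x → 𝟙 (x ≟ u) *ℕ 1 +ℕ 𝟙 (x ≟ w) *ℕ 1)        ≡⟨ cong (deg u +ℕ_) (trans (∑-distrib-+ {n} (λ x → 𝟙 (x ≟ u) *ℕ 1) _)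
                                                                     (cong₂ _+ℕ_ (sum-single (λ _ → 1) u) (sum-single (λ _ → 1) w))) ⟩
    deg u +ℕ 2                                                  ∎
    where
    open Adjacency G
    open ℕ.≤-Reasoning
    covered : ∀ x → 1 ≤ℕ e u x +ℕ (𝟙 (x ≟ u) *ℕ 1 +ℕ 𝟙 (x ≟ w) *ℕ 1)
    covered x with cover x
    ... | inj₁ x≡u        rewrite 𝟙-yes (x ≟ u) x≡u = ℕ.≤-trans (ℕ.m≤n+m 1 (e u x)) (ℕ.+-monoʳ-≤ (e u x) (ℕ.m≤m+n 1 _))
    ... | inj₂ (inj₁ x≡w) rewrite 𝟙-yes (x ≟ w) x≡w = ℕ.≤-trans (ℕ.m≤n+m 1 (𝟙 (x ≟ u) *ℕ 1)) (ℕ.m≤n+m _ (e u x))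
    ... | inj₂ (inj₂ u∼x) = subst (λ t → 1 ≤ℕ t +ℕ (𝟙 (x ≟ u) *ℕ 1 +ℕ 𝟙 (x ≟ w) *ℕ 1)) (sym (edge u∼x)) (s≤s z≤n)

  triangles∙C₄-cover : ∀ t x → x ≡ zero ⊎ x ≡ suc (t *ℕ 2) ↑ʳ 1F ⊎ Graph._∼_ (triangles∙C₄ t) zero x
  triangles∙C₄-cover t x with splitAt (suc (t *ℕ 2)) x in eq
  ... | inj₁ zero    = inj₁ (sym (Fin.splitAt⁻¹-↑ˡ {suc (t *ℕ 2)} eq))
  ... | inj₁ (suc i) = inj₂ (inj₂ tt)
  ... | inj₂ 0F      = inj₂ (inj₂ (refl , toWitness {a? = Graph._∼?_ (cycle 4) 0F 1F} tt))
  ... | inj₂ 1F      = inj₂ (inj₁ (sym (Fin.splitAt⁻¹-↑ʳ {suc (t *ℕ 2)} eq)))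
  ... | inj₂ 2F      = inj₂ (inj₂ (refl , toWitness {a? = Graph._∼?_ (cycle 4) 0F 3F} tt))

  -- The centre misses only itself and the opposite vertex of the 4-cycle. This rules out an
  -- isomorphism when all degrees are at most `1 + 2t`.
  ≅triangles∙C₄⇒large-degree : ∀ {n} {G : Graph n} {t} → G ≅ triangles∙C₄ t → ∃ λ u → 1 +ℕ 2 *ℕ t <ℕ Adjacency.deg G u
  ≅triangles∙C₄⇒large-degree {n} {G} {t} (φ , φ-∼) = u , ℕ.+-cancelʳ-≤ 2 (suc (1 +ℕ 2 *ℕ t)) (Adjacency.deg G u) (begin
      suc (1 +ℕ 2 *ℕ t) +ℕ 2     ≡⟨ collect t ⟩
      suc (t *ℕ 2) +ℕ 3          ≡⟨ ↔⇒≡ φ ⟨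
      n                          ≤⟨ two-missed⇒order≤ G cover ⟩
      Adjacency.deg G u +ℕ 2     ∎)
    where
    open ℕ.≤-Reasoning
    open Inverse φ using (to; from; strictlyInverseˡ; strictlyInverseʳ)
    H = triangles∙C₄ t
    u = from zero
    w = from (suc (t *ℕ 2) ↑ʳ 1F)
    collect : ∀ t → suc (1 +ℕ 2 *ℕ t) +ℕ 2 ≡ suc (t *ℕ 2) +ℕ 3
    collect = solve-∀
    cover : ∀ x → x ≡ u ⊎ x ≡ w ⊎ Graph._∼_ G u x
    cover x with triangles∙C₄-cover t (to x)
    ... | inj₁ x≡0        = inj₁ (trans (sym (strictlyInverseʳ x)) (cong from x≡0))
    ... | inj₂ (inj₁ x≡w) = inj₂ (inj₁ (trans (sym (strictlyInverseʳ x)) (cong from x≡w)))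
    ... | inj₂ (inj₂ 0∼x) = inj₂ (inj₂ (Equivalence.from (φ-∼ u x)
                              (subst (λ c → Graph._∼_ H c (to x)) (sym (strictlyInverseˡ zero)) 0∼x)))

  -- Both divisions are exact, as `2m - 5 = 3 (2κ + 1)`.
  triangle-count : ∀ κ → ((2 *ℕ (3 *ℕ κ +ℕ 4) ∸ 5) / 3 ∸ 1) / 2 ≡ κ
  triangle-count κ = begin
    ((2 *ℕ (3 *ℕ κ +ℕ 4) ∸ 5) / 3 ∸ 1) / 2        ≡⟨ cong (λ z → ((z ∸ 5) / 3 ∸ 1) / 2) (collect κ) ⟩
    (((1 +ℕ κ *ℕ 2) *ℕ 3 +ℕ 5 ∸ 5) / 3 ∸ 1) / 2   ≡⟨ cong (λ z → (z / 3 ∸ 1) / 2) (ℕ.m+n∸n≡m ((1 +ℕ κ *ℕ 2) *ℕ 3) 5) ⟩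
    ((1 +ℕ κ *ℕ 2) *ℕ 3 / 3 ∸ 1) / 2              ≡⟨ cong (λ z → (z ∸ 1) / 2) (m*n/n≡m (1 +ℕ κ *ℕ 2) 3) ⟩
    κ *ℕ 2 / 2                                    ≡⟨ m*n/n≡m κ 2 ⟩
    κ                                             ∎
    where
    open ≡-Reasoning
    collect : ∀ κ → 2 *ℕ (3 *ℕ κ +ℕ 4) ≡ (1 +ℕ κ *ℕ 2) *ℕ 3 +ℕ 5
    collect = solve-∀

  module Comparison (ℝ : RealNumbers) (κ : ℕ) (3≤κ : 3 ≤ℕ κ) {n} (G : Graph n)
      {q q′ : RealNumbers.Carrier ℝ} (radius : IsSignlessLaplacianRadius ℝ G q)
      (largest : IsLargestRoot ℝ (3 *ℕ κ +ℕ 4) q′) where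
    open OrderedField ℝ
    open Spectrum ℝ
    open LargestRoot ℝ κ
    open ≈-Reasoning

    1≤κ : 1 ≤ℕ κ
    1≤κ = ℕ.≤-trans (s≤s z≤n) 3≤κ

    Y : ℕ
    Y = 1 +ℕ 2 *ℕ κ

    extremal : TrianglesAndCycle G → n ≡ 2 *ℕ κ +ℕ 4 → q ≈ q′
    extremal S order = positive-eigenvector⇒radius G radius (TrianglesAndCycle.u S) X 0<X eigen
      where
      open Eigenvector S κ order q′ (<-trans (2<y 1≤κ) (y<q-2 1≤κ largest)) (cubic-root 1≤κ largest)

    -- `radius-bound` with the degrees as weights, `c = y` and `L = (1 + y)²`, which avoids dividing
    -- by `y`.
    strict : let open Adjacency G in (∀ v → 2 ≤ℕ deg v) →
      (∀ v → Y *ℕ sum (λ x → e v x *ℕ (deg v +ℕ deg x)) ≤ℕ (1 +ℕ Y) *ℕ (1 +ℕ Y) *ℕ deg v) → q < q′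
    strict 2≤deg bound = <-certificate 0<q′-q (solve 2 (λ q r → r := q :+ (r :- q)) refl-≈ q q′)
      where
      open Adjacency G
      refl-≈ = OrderedField.refl ℝ
      real-bound : ∀ v → y * action G (λ x → ι (deg x)) v ≤ (ι 1 + y) * (ι 1 + y) * ι (deg v)
      real-bound v = ≤-respˡ-≈ (begin
          ι (Y *ℕ sum (λ x → e v x *ℕ (deg v +ℕ deg x)))           ≈⟨ ι-* Y (sum (λ x → e v x *ℕ (deg v +ℕ deg x))) ⟩
          y * ι (sum (λ x → e v x *ℕ (deg v +ℕ deg x)))            ≈⟨ *-congˡ (ι-sum (λ x → e v x *ℕ (deg v +ℕ deg x))) ⟩
          y * ∑ (λ x → ι (e v x *ℕ (deg v +ℕ deg x)))              ≈⟨ *-congˡ (sum-cong (λ x → ≈-trans (ι-* (e v x) _) (*-cong (ι-e G v x) (ι-+ (deg v) (deg x))))) ⟩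
          y * action G (λ x → ι (deg x)) v                         ∎)
        (≤-respʳ-≈ (begin
          ι ((1 +ℕ Y) *ℕ (1 +ℕ Y) *ℕ deg v)                        ≈⟨ ι-* ((1 +ℕ Y) *ℕ (1 +ℕ Y)) (deg v) ⟩
          ι ((1 +ℕ Y) *ℕ (1 +ℕ Y)) * ι (deg v)                     ≈⟨ *-congʳ (≈-trans (ι-* (1 +ℕ Y) (1 +ℕ Y)) (*-cong (ι-+ 1 Y) (ι-+ 1 Y))) ⟩
          (ι 1 + y) * (ι 1 + y) * ι (deg v)                        ∎)
        (ι-mono-≤ (bound v)))
        where ≈-trans = OrderedField.trans ℝ
      yq<yq′ : y * q < y * q′
      yq<yq′ = ≤-<-trans
        (radius-bound G radius (λ x → ι (deg x)) 0<deg (<⇒≤ (0<y 1≤κ)) real-bound)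
        ([1+y]²<yq 1≤κ largest)
        where
        0<deg : ∀ v → 0# < ι (deg v)
        0<deg v = <-≤-trans (0<ι 2) (ι-mono-≤ (2≤deg v))
      0<q′-q : 0# < q′ - q
      0<q′-q = *-cancelˡ-pos (0<y 1≤κ) (<-respʳ-≈ (solve 3 (λ y q r → y :* r :- y :* q := y :* (r :- q)) refl-≈ y q q′) (x<y⇒0<y-x yq<yq′))

  extremal-theorem : (ℝ : RealNumbers) →
      (κ : ℕ) → 3 ≤ℕ κ →
      ∀ {n} (G : Graph n) →
      Connected G →
      Free ((_ , θ (1 ∷ 2 ∷ 2 ∷ [])) ∷ (_ , θ (1 ∷ 2 ∷ 3 ∷ [])) ∷ []) G →
      size G ≡ 3 *ℕ κ +ℕ 4 →
      NoPendantVertex G →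
      (q q′ : RealNumbers.Carrier ℝ) →
      IsSignlessLaplacianRadius ℝ G q →
      IsLargestRoot ℝ (3 *ℕ κ +ℕ 4) q′ →
      let open RealNumbers ℝ in
      (q ≤ q′) × ((q ≈ q′) ⇔ (G ≅ triangles∙C₄ κ))
  extremal-theorem ℝ κ 3≤κ {n} G connected (no-diamond ∷ no-house ∷ []) size≡ no-pendant q q′ radius largest =
    -- This split is decidable, whereas comparing `q` with `q′` directly is not.
    conclude (Fin.any? (λ u → (1 +ℕ 2 *ℕ κ) <ℕ? deg u))
    where
    open Adjacency G using (deg; handshake)
    open OrderedField ℝ using (_≤_; _≈_; ≤-reflexive; <⇒≤; <-irrefl)
    open Comparison ℝ κ 3≤κ G radius largest

    degrees : ∀ v → 2 ≤ℕ deg v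
    degrees = 2≤deg G connected (subst (1 ≤ℕ_) (trans (ℕ.+-comm 4 (3 *ℕ κ)) (sym size≡)) (s≤s z≤n)) no-pendant

    open module Bound u = DegreeBound G κ 3≤κ (trans handshake (cong (2 *ℕ_) size≡)) degrees no-diamond no-house u
      using (degree-bound; module LargeDegree)

    conclude : Dec (∃ λ u → 1 +ℕ 2 *ℕ κ <ℕ deg u) → (q ≤ q′) × ((q ≈ q′) ⇔ (G ≅ triangles∙C₄ κ))
    conclude (yes (u , Y<deg)) = ≤-reflexive q≈q′ , mk⇔ (λ _ → G≅H) (λ _ → q≈q′)
      where
      S = proj₁ (LargeDegree.structure×order u Y<deg)
      order = proj₂ (LargeDegree.structure×order u Y<deg)
      q≈q′ = extremal S order
      -- The order of `G` is both `2t + 4` and `2κ + 4`.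
      t≡κ : Structure.t S ≡ κ
      t≡κ = ℕ.*-cancelʳ-≡ (Structure.t S) κ 2 (ℕ.suc-injective (ℕ.+-cancelʳ-≡ 3 (suc (Structure.t S *ℕ 2)) (suc (κ *ℕ 2))
        (trans (sym (Structure.order≡ S)) (trans order (collect κ)))))
        where
        collect : ∀ κ → 2 *ℕ κ +ℕ 4 ≡ suc (κ *ℕ 2) +ℕ 3
        collect = solve-∀
      G≅H : G ≅ triangles∙C₄ κ
      G≅H = subst (λ t → G ≅ triangles∙C₄ t) t≡κ (Structure.isomorphism S)
    conclude (no small) = <⇒≤ q<q′ , mk⇔ (λ q≈q′ → contradiction q<q′ (<-irrefl q≈q′))
        (λ G≅H → contradiction (≅triangles∙C₄⇒large-degree {G = G} {κ} G≅H) small)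
      where
      q<q′ = strict degrees (λ v → degree-bound v (ℕ.≮⇒≥ (λ Y<deg → small (v , Y<deg))))

open import Data.Nat using (suc; s≤s)
open import Data.Nat.Tactic.RingSolver using (solve-∀)
open import Relation.Binary.PropositionalEquality using (refl; sym; trans; subst)
open Recognition using (triangles∙C₄)
open Comparisons using (triangle-count; extremal-theorem)

theorem4p1 : (ℝ : RealNumbers) →
    (k m : ℕ) → 4 ≤ℕ k → m ≡ 3 *ℕ k +ℕ 1 →
    ∀ {n} (G : Graph n) →
    Connected G →
    Free ((_ , θ (1 ∷ 2 ∷ 2 ∷ [])) ∷ (_ , θ (1 ∷ 2 ∷ 3 ∷ [])) ∷ []) G →
    size G ≡ m →
    NoPendantVertex G →
    (q q′ : RealNumbers.Carrier ℝ) →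
    IsSignlessLaplacianRadius ℝ G q →
    IsLargestRoot ℝ m q′ →
    let open RealNumbers ℝ in
    (q ≤ q′) × ((q ≈ q′) ⇔ (G ≅ Hgraph ((2 *ℕ m ∸ 5) / 3) 4))
theorem4p1 ℝ (suc κ) m (s≤s 3≤κ) m≡ G connected free size≡ no-pendant q q′ radius largest
  with trans m≡ (reindex κ)
  where
  reindex : ∀ κ → 3 *ℕ suc κ +ℕ 1 ≡ 3 *ℕ κ +ℕ 4
  reindex = solve-∀
-- `Hgraph p 4` unfolds to `triangles∙C₄ ((p ∸ 1) / 2)`, so rewriting the number of triangles
-- suffices.
... | refl = subst (λ t → (q ≤ q′) × ((q ≈ q′) ⇔ (G ≅ triangles∙C₄ t))) (sym (triangle-count κ))
  (extremal-theorem ℝ κ 3≤κ G connected free size≡ no-pendant q q′ radius largest)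
  where open RealNumbers ℝ using (_≤_; _≈_)
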